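{- $$\sum_{k=0}^{\infty}(3k+2)\frac{(1)_k^3}{\left(\frac{3}{2}\right)_k^3\,4^k}\left\{H_{2k+1}^{(2)}-\frac{5}{4}H_{k}^{(2)}\right\}=\frac{\pi^4}{48}.$$
   Context: For a complex number $x$ and a nonnegative integer $n$, the shifted factorial is $(x)_n=\Gamma(x+n)/\Gamma(x)$, i.e. $(x)_0=1$ and $(x)_n=x(x+1)\cdots(x+n-1)$ for $n\ge 1$; $(x)_k^3$ means $((x)_k)^3$. The harmonic number of order two is $H_n^{(2)}=\sum_{j=1}^{n}\frac{1}{j^2}$, with $H_0^{(2)}=0$. -}

module Defs where

open import Data.Integer.Base as ℤ using (ℤ; +_; +[1+_]; -[1+_])
open import Data.Nat.Base as ℕ using (ℕ; zero; suc)
import Data.Nat.Properties as ℕ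
open import Data.Product.Base using (∃-syntax; _×_; _,_; proj₁; proj₂)
open import Data.Rational.Base
open import Data.Rational.Properties
open import Data.Rational.Solver using (module +-*-Solver)
import Data.Rational.Unnormalised.Base as ℚᵘ
import Data.Integer.Properties as ℤ
open import Data.Sum.Base using (inj₁; inj₂)
open import Relation.Binary.PropositionalEquality.Core
  using (_≡_; refl; sym; trans; cong; cong₂; subst; subst₂)
open import Algebra.Definitions.RawSemiring +-*-rawSemiring public using (_^_)

∑ : ℕ → (ℕ → ℚ) → ℚ
∑ zero    f = 0ℚ
∑ (suc n) f = ∑ n f + f n

∣∣-bound : ∀ {p c} → p ≤ c → - p ≤ c → ∣ p ∣ ≤ c
∣∣-bound {p} p≤c -p≤c with ∣p∣≡p∨∣p∣≡-p p
... | inj₁ e = subst (_≤ _) (sym e) p≤c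
... | inj₂ e = subst (_≤ _) (sym e) -p≤c

p≤∣p∣ : ∀ p → p ≤ ∣ p ∣
p≤∣p∣ p with ≤-total 0ℚ p
... | inj₁ 0≤p = ≤-reflexive (sym (0≤p⇒∣p∣≡p 0≤p))
... | inj₂ p≤0 = ≤-trans p≤0 (0≤∣p∣ p)

∣-∣-sym : ∀ p q → ∣ p - q ∣ ≡ ∣ q - p ∣
∣-∣-sym p q = trans (sym (∣-p∣≡∣p∣ (p - q)))
  (cong ∣_∣ (solve 2 (λ p q → :- (p :- q) := q :- p) refl p q))
  where open +-*-Solver

∣p∣≤∣q∣+∣p-q∣ : ∀ p q → ∣ p ∣ ≤ ∣ q ∣ + ∣ p - q ∣
∣p∣≤∣q∣+∣p-q∣ p q = subst (λ r → ∣ r ∣ ≤ ∣ q ∣ + ∣ p - q ∣)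
  (solve 2 (λ p q → q :+ (p :- q) := p) refl p q)
  (∣p+q∣≤∣p∣+∣q∣ q (p - q))
  where open +-*-Solver

∣p∣-∣q∣≤∣p-q∣ : ∀ p q → ∣ p ∣ - ∣ q ∣ ≤ ∣ p - q ∣
∣p∣-∣q∣≤∣p-q∣ p q = subst (∣ p ∣ - ∣ q ∣ ≤_)
  (solve 2 (λ a b → (a :+ b) :- a := b) refl ∣ q ∣ ∣ p - q ∣)
  (+-monoˡ-≤ (- ∣ q ∣) (∣p∣≤∣q∣+∣p-q∣ p q))
  where open +-*-Solver

∣∣p∣-∣q∣∣≤∣p-q∣ : ∀ p q → ∣ ∣ p ∣ - ∣ q ∣ ∣ ≤ ∣ p - q ∣
∣∣p∣-∣q∣∣≤∣p-q∣ p q = ∣∣-bound (∣p∣-∣q∣≤∣p-q∣ p q)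
  (subst₂ _≤_
    (solve 2 (λ a b → b :- a := :- (a :- b)) refl ∣ p ∣ ∣ q ∣)
    (∣-∣-sym q p)
    (∣p∣-∣q∣≤∣p-q∣ q p))
  where open +-*-Solver

halve : ∀ {ε} → 0ℚ < ε → 0ℚ < ½ * ε
halve 0<ε = *-monoʳ-<-pos ½ 0<ε

halves : ∀ ε → ½ * ε + ½ * ε ≡ ε
halves = solve 1 (λ e → con ½ :* e :+ con ½ :* e := e) refl
  where open +-*-Solver

1/suc-below : ∀ ε → 0ℚ < ε → ∃[ q ] + 1 / suc q ≤ ε
1/suc-below ε@(mkℚ +[1+ n ] d c) _ = d , toℚᵘ-cancel-≤ (begin
    toℚᵘ (+ 1 / suc d)   ≃⟨ toℚᵘ-fromℚᵘ (ℚᵘ.mkℚᵘ (+ 1) d) ⟩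
    ℚᵘ.mkℚᵘ (+ 1) d      ≤⟨ ℚᵘ.*≤* (ℤ.*-monoʳ-≤-nonNeg (+ suc d) {+ 1} {+ suc n} (ℤ.+≤+ (ℕ.s≤s ℕ.z≤n))) ⟩
    toℚᵘ ε               ∎)
  where
    import Data.Rational.Unnormalised.Properties as ℚᵘP
    open ℚᵘP.≤-Reasoning
1/suc-below (mkℚ (+ zero) d c)  (*<* (ℤ.+<+ ()))
1/suc-below (mkℚ -[1+ n ] d c) (*<* ())

IsCauchy : (ℕ → ℚ) → Set
IsCauchy x = ∀ ε → 0ℚ < ε →
  ∃[ N ] ∀ m n → N ℕ.≤ m → N ℕ.≤ n → ∣ x m - x n ∣ < ε

record ℝ : Set where
  constructor mkℝ
  field
    approx : ℕ → ℚ
    cauchy : IsCauchy approx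

open ℝ public

infix 4 _≤ℝ_

-- Two sequences denote the same real number when  x ≤ℝ y × y ≤ℝ x,  so
-- propositional equality on ℝ is too fine to serve as equality of reals.
_≤ℝ_ : ℝ → ℝ → Set
x ≤ℝ y = ∀ ε → 0ℚ < ε → ∃[ N ] ∀ n → N ℕ.≤ n → approx x n ≤ approx y n + ε

fromℚ : ℚ → ℝ
fromℚ q = mkℝ (λ _ → q) λ ε 0<ε →
  0 , λ _ _ _ _ → subst (_< ε) (cong ∣_∣ (sym (+-inverseʳ q))) 0<ε

+-cauchy : ∀ {x y} → IsCauchy x → IsCauchy y → IsCauchy (λ n → x n + y n)
+-cauchy {x} {y} cx cy ε 0<ε with cx (½ * ε) (halve 0<ε) | cy (½ * ε) (halve 0<ε)
... | M , hM | N , hN = M ℕ.⊔ N , λ m n hm hn → begin-strict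
    ∣ (x m + y m) - (x n + y n) ∣   ≡⟨ cong ∣_∣ (rearrange (x m) (y m) (x n) (y n)) ⟩
    ∣ (x m - x n) + (y m - y n) ∣   ≤⟨ ∣p+q∣≤∣p∣+∣q∣ (x m - x n) (y m - y n) ⟩
    ∣ x m - x n ∣ + ∣ y m - y n ∣   <⟨ +-mono-<
                                          (hM m n (ℕ.m⊔n≤o⇒m≤o M N hm) (ℕ.m⊔n≤o⇒m≤o M N hn))
                                          (hN m n (ℕ.m⊔n≤o⇒n≤o M N hm) (ℕ.m⊔n≤o⇒n≤o M N hn)) ⟩
    ½ * ε + ½ * ε   ≡⟨ halves ε ⟩
    ε               ∎
  where
    open ≤-Reasoning
    rearrange : ∀ a b c d → (a + b) - (c + d) ≡ (a - c) + (b - d)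
    rearrange = solve 4 (λ a b c d → (a :+ b) :- (c :+ d) := (a :- c) :+ (b :- d)) refl
      where open +-*-Solver

neg-cauchy : ∀ {x} → IsCauchy x → IsCauchy (λ n → - x n)
neg-cauchy {x} cx ε 0<ε with cx ε 0<ε
... | N , h = N , λ m n hm hn →
  subst (_< ε) (trans (∣-∣-sym (x m) (x n)) (cong ∣_∣ (rearrange (x m) (x n)))) (h m n hm hn)
  where
    rearrange : ∀ a b → b - a ≡ - a - - b
    rearrange = solve 2 (λ a b → b :- a := (:- a) :- (:- b)) refl
      where open +-*-Solver

abs-cauchy : ∀ {x} → IsCauchy x → IsCauchy (λ n → ∣ x n ∣)
abs-cauchy {x} cx ε 0<ε with cx ε 0<ε
... | N , h = N , λ m n hm hn → ≤-<-trans (∣∣p∣-∣q∣∣≤∣p-q∣ (x m) (x n)) (h m n hm hn)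

cauchy-bound : ∀ {x} → IsCauchy x → ∃[ B ] ∃[ N ] ∀ n → N ℕ.≤ n → ∣ x n ∣ < B
cauchy-bound {x} cx with cx 1ℚ (positive⁻¹ 1ℚ)
... | N , h = ∣ x N ∣ + 1ℚ , N , λ n hn →
  ≤-<-trans (∣p∣≤∣q∣+∣p-q∣ (x n) (x N)) (+-monoʳ-< ∣ x N ∣ (h n N hn ℕ.≤-refl))

product-< : ∀ {p q b d} → ∣ p ∣ < b → ∣ q ∣ < d → ∣ p * q ∣ < b * d
product-< {p} {q} {b} {d} p<b q<d = begin-strict
    ∣ p * q ∣       ≡⟨ ∣p*q∣≡∣p∣*∣q∣ p q ⟩
    ∣ p ∣ * ∣ q ∣   ≤⟨ *-monoˡ-≤-nonNeg ∣ p ∣ {{∣-∣-nonNeg p}} (<⇒≤ q<d) ⟩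
    ∣ p ∣ * d       <⟨ *-monoˡ-<-pos d {{positive (≤-<-trans (0≤∣p∣ q) q<d)}} p<b ⟩
    b * d           ∎
  where open ≤-Reasoning

product-difference : ∀ {p q r s A B α β ε} →
  ∣ p ∣ < A → ∣ s ∣ < B → ∣ q - s ∣ < α → ∣ p - r ∣ < β →
  A * α + B * β ≡ ε → ∣ p * q - r * s ∣ < ε
product-difference {p} {q} {r} {s} {A} {B} {α} {β} {ε} hA hB hα hβ e = begin-strict
    ∣ p * q - r * s ∣                   ≡⟨ cong ∣_∣ (rearrange p q r s) ⟩
    ∣ p * (q - s) + s * (p - r) ∣       ≤⟨ ∣p+q∣≤∣p∣+∣q∣ (p * (q - s)) (s * (p - r)) ⟩
    ∣ p * (q - s) ∣ + ∣ s * (p - r) ∣   <⟨ +-mono-< (product-< {p} {q - s} {A} {α} hA hα)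
                                                      (product-< {s} {p - r} {B} {β} hB hβ) ⟩
    A * α + B * β   ≡⟨ e ⟩
    ε               ∎
  where
    open ≤-Reasoning
    rearrange : ∀ a b c d → a * b - c * d ≡ a * (b - d) + d * (a - c)
    rearrange = solve 4 (λ a b c d → a :* b :- c :* d := a :* (b :- d) :+ d :* (a :- c)) refl
      where open +-*-Solver

quotient : ∀ C δ → 0ℚ < C → 0ℚ < δ → ∃[ α ] (0ℚ < α × C * α ≡ δ)
quotient C δ 0<C 0<δ = 1/ C * δ , α-pos , C*α≡δ
  where
    instance
      C-pos : Positive C
      C-pos = positive 0<C
      C-nonZero : NonZero C
      C-nonZero = pos⇒nonZero C
    α-pos : 0ℚ < 1/ C * δ
    α-pos = positive⁻¹ (1/ C * δ) {{pos*pos⇒pos (1/ C) {{1/pos⇒pos C}} δ {{positive 0<δ}}}}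
    C*α≡δ : C * (1/ C * δ) ≡ δ
    C*α≡δ = trans (sym (*-assoc C (1/ C) δ))
      (trans (cong (_* δ) (*-inverseʳ C)) (*-identityˡ δ))

*-cauchy : ∀ {x y} → IsCauchy x → IsCauchy y → IsCauchy (λ n → x n * y n)
*-cauchy {x} {y} cx cy ε 0<ε = from-bounds (cauchy-bound cx) (cauchy-bound cy)
  where
    Goal = ∃[ N ] ∀ m n → N ℕ.≤ m → N ℕ.≤ n → ∣ x m * y m - x n * y n ∣ < ε
    Bound : (ℕ → ℚ) → ℚ → ℕ → Set
    Bound z B N = ∀ n → N ℕ.≤ n → ∣ z n ∣ < B
    Close : (ℕ → ℚ) → ℚ → ℕ → Set
    Close z δ N = ∀ m n → N ℕ.≤ m → N ℕ.≤ n → ∣ z m - z n ∣ < δ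
    Quotient : ℚ → ℚ → Set
    Quotient C α = 0ℚ < α × C * α ≡ ½ * ε
    combine : ∀ A B α β M₀ N₀ M₁ N₁ → Bound x A M₀ → Bound y B N₀ →
              Close x β M₁ → Close y α N₁ → A * α + B * β ≡ ε → Goal
    combine A B α β M₀ N₀ M₁ N₁ hA hB hM hN e =
      (M₀ ℕ.⊔ M₁) ℕ.⊔ (N₀ ℕ.⊔ N₁) , λ m n hm hn →
      let Mm = ℕ.m⊔n≤o⇒m≤o (M₀ ℕ.⊔ M₁) (N₀ ℕ.⊔ N₁) hm
          Nm = ℕ.m⊔n≤o⇒n≤o (M₀ ℕ.⊔ M₁) (N₀ ℕ.⊔ N₁) hm
          Mn = ℕ.m⊔n≤o⇒m≤o (M₀ ℕ.⊔ M₁) (N₀ ℕ.⊔ N₁) hn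
          Nn = ℕ.m⊔n≤o⇒n≤o (M₀ ℕ.⊔ M₁) (N₀ ℕ.⊔ N₁) hn
      in product-difference {x m} {y m} {x n} {y n} {A} {B} {α} {β} {ε}
           (hA m (ℕ.m⊔n≤o⇒m≤o M₀ M₁ Mm))
           (hB n (ℕ.m⊔n≤o⇒m≤o N₀ N₁ Nn))
           (hN m n (ℕ.m⊔n≤o⇒n≤o N₀ N₁ Nm) (ℕ.m⊔n≤o⇒n≤o N₀ N₁ Nn))
           (hM m n (ℕ.m⊔n≤o⇒n≤o M₀ M₁ Mm) (ℕ.m⊔n≤o⇒n≤o M₀ M₁ Mn))
           e
    add : ∀ {A B α β} → A * α ≡ ½ * ε → B * β ≡ ½ * ε → A * α + B * β ≡ ε
    add {A} {B} {α} {β} p q =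
      trans {j = ½ * ε + ½ * ε} (cong₂ _+_ {A * α} {½ * ε} {B * β} {½ * ε} p q) (halves ε)
    from-quotients : ∀ {A B M₀ N₀} → Bound x A M₀ → Bound y B N₀ →
                     ∃[ α ] Quotient A α → ∃[ β ] Quotient B β → Goal
    from-quotients {A} {B} {M₀} {N₀} hA hB (α , 0<α , Aα) (β , 0<β , Bβ) =
      combine A B α β M₀ N₀ (proj₁ (cx β 0<β)) (proj₁ (cy α 0<α)) hA hB
        (proj₂ (cx β 0<β)) (proj₂ (cy α 0<α)) (add {A} {B} {α} {β} Aα Bβ)
    from-bounds : (∃[ A ] ∃[ N ] Bound x A N) → (∃[ B ] ∃[ N ] Bound y B N) → Goal
    from-bounds (A , M₀ , hA) (B , N₀ , hB) = from-quotients {A} {B} {M₀} {N₀} hA hB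
      (quotient A (½ * ε) (≤-<-trans (0≤∣p∣ (x M₀)) (hA M₀ ℕ.≤-refl)) (halve 0<ε))
      (quotient B (½ * ε) (≤-<-trans (0≤∣p∣ (y N₀)) (hB N₀ ℕ.≤-refl)) (halve 0<ε))

infixl 6 _+ℝ_ _-ℝ_
infixl 7 _*ℝ_
infixr 8 _^ℝ_

_+ℝ_ : ℝ → ℝ → ℝ
mkℝ x cx +ℝ mkℝ y cy = mkℝ (λ n → x n + y n) (+-cauchy {x} {y} cx cy)

-ℝ_ : ℝ → ℝ
-ℝ mkℝ x cx = mkℝ (λ n → - x n) (neg-cauchy {x} cx)

_-ℝ_ : ℝ → ℝ → ℝ
x -ℝ y = x +ℝ (-ℝ y)

_*ℝ_ : ℝ → ℝ → ℝ
mkℝ x cx *ℝ mkℝ y cy = mkℝ (λ n → x n * y n) (*-cauchy {x} {y} cx cy)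

∣_∣ℝ : ℝ → ℝ
∣ mkℝ x cx ∣ℝ = mkℝ (λ n → ∣ x n ∣) (abs-cauchy {x} cx)

_^ℝ_ : ℝ → ℕ → ℝ
x ^ℝ zero  = fromℚ 1ℚ
x ^ℝ suc n = x *ℝ x ^ℝ n

∑ℝ : ℕ → (ℕ → ℝ) → ℝ
∑ℝ zero    f = fromℚ 0ℚ
∑ℝ (suc n) f = ∑ℝ n f +ℝ f n

-- Rational ε suffice, since every positive real exceeds a positive rational.
ConvergesTo : (ℕ → ℝ) → ℝ → Set
ConvergesTo s L = ∀ ε → 0ℚ < ε →
  ∃[ N ] ∀ n → N ℕ.≤ n → ∣ s n -ℝ L ∣ℝ ≤ℝ fromℚ ε

HasSum : (ℕ → ℝ) → ℝ → Set
HasSum a S = ConvergesTo (λ n → ∑ℝ n a) S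

leibnizTerm : ℕ → ℚ
leibnizTerm k = + 4 / suc (2 ℕ.* k)

leibniz : ℕ → ℚ
leibniz n = ∑ n (λ k → (- 1ℚ) ^ k * leibnizTerm k)

0≤leibnizTerm : ∀ k → 0ℚ ≤ leibnizTerm k
0≤leibnizTerm k = nonNegative⁻¹ (leibnizTerm k) {{normalize-nonNeg 4 (suc (2 ℕ.* k))}}

leibnizTerm-anti : ∀ {j k} → j ℕ.≤ k → leibnizTerm k ≤ leibnizTerm j
leibnizTerm-anti {j} {k} j≤k = toℚᵘ-cancel-≤ (begin
  toℚᵘ (leibnizTerm k)      ≃⟨ toℚᵘ-fromℚᵘ (ℚᵘ.mkℚᵘ (+ 4) (2 ℕ.* k)) ⟩
  ℚᵘ.mkℚᵘ (+ 4) (2 ℕ.* k)   ≤⟨ ℚᵘ.*≤* (ℤ.*-monoˡ-≤-nonNeg (+ 4) (ℤ.+≤+ (ℕ.s≤s (ℕ.*-monoʳ-≤ 2 j≤k)))) ⟩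
  ℚᵘ.mkℚᵘ (+ 4) (2 ℕ.* j)   ≃⟨ toℚᵘ-fromℚᵘ (ℚᵘ.mkℚᵘ (+ 4) (2 ℕ.* j)) ⟨
  toℚᵘ (leibnizTerm j)                   ∎)
  where
    import Data.Rational.Unnormalised.Properties as ℚᵘP
    open ℚᵘP.≤-Reasoning

leibnizTail : ℕ → ℕ → ℚ
leibnizTail n zero    = 0ℚ
leibnizTail n (suc d) = leibnizTerm n - leibnizTail (suc n) d

leibnizTail-bounds : ∀ n d → 0ℚ ≤ leibnizTail n d × leibnizTail n d ≤ leibnizTerm n
leibnizTail-bounds n zero    = ≤-refl , 0≤leibnizTerm n
leibnizTail-bounds n (suc d) with leibnizTail-bounds (suc n) d
... | 0≤t , t≤a =
  subst (_≤ leibnizTerm n - leibnizTail (suc n) d) (+-inverseʳ (leibnizTail (suc n) d))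
    (+-monoˡ-≤ (- leibnizTail (suc n) d) (≤-trans t≤a (leibnizTerm-anti (ℕ.n≤1+n n)))) ,
  subst (leibnizTerm n - leibnizTail (suc n) d ≤_) (+-identityʳ (leibnizTerm n))
    (+-monoʳ-≤ (leibnizTerm n) (neg-antimono-≤ 0≤t))

leibniz-tail : ∀ n d → leibniz (n ℕ.+ d) - leibniz n ≡ (- 1ℚ) ^ n * leibnizTail n d
leibniz-tail n zero =
  trans (cong (λ k → leibniz k - leibniz n) (ℕ.+-identityʳ n))
    (trans (+-inverseʳ (leibniz n)) (sym (*-zeroʳ ((- 1ℚ) ^ n))))
leibniz-tail n (suc d) = begin
  leibniz (n ℕ.+ suc d) - leibniz n
    ≡⟨ cong (λ k → leibniz k - leibniz n) (ℕ.+-suc n d) ⟩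
  leibniz (suc n ℕ.+ d) - leibniz n
    ≡⟨ split (leibniz (suc n ℕ.+ d)) (leibniz n) (s * leibnizTerm n) ⟩
  (leibniz (suc n ℕ.+ d) - leibniz (suc n)) + s * leibnizTerm n
    ≡⟨ cong (_+ s * leibnizTerm n) (leibniz-tail (suc n) d) ⟩
  (- 1ℚ) * s * leibnizTail (suc n) d + s * leibnizTerm n
    ≡⟨ merge s (leibnizTail (suc n) d) (leibnizTerm n) ⟩
  s * leibnizTail n (suc d)   ∎
  where
    open import Relation.Binary.PropositionalEquality.Properties
    open ≡-Reasoning
    open +-*-Solver
    s = (- 1ℚ) ^ n
    split : ∀ p q r → p - q ≡ (p - (q + r)) + r
    split = solve 3 (λ p q r → p :- q := (p :- (q :+ r)) :+ r) refl
    merge : ∀ s t b → (- 1ℚ) * s * t + s * b ≡ s * (b - t)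
    merge = solve 3 (λ s t b → con (- 1ℚ) :* s :* t :+ s :* b := s :* (b :- t)) refl

∣sign∣ : ∀ n → ∣ (- 1ℚ) ^ n ∣ ≡ 1ℚ
∣sign∣ zero    = refl
∣sign∣ (suc n) = trans (∣p*q∣≡∣p∣*∣q∣ (- 1ℚ) ((- 1ℚ) ^ n)) (trans (*-identityˡ _) (∣sign∣ n))

leibniz-close : ∀ n d → ∣ leibniz (n ℕ.+ d) - leibniz n ∣ ≤ leibnizTerm n
leibniz-close n d = begin
  ∣ leibniz (n ℕ.+ d) - leibniz n ∣      ≡⟨ cong ∣_∣ (leibniz-tail n d) ⟩
  ∣ (- 1ℚ) ^ n * leibnizTail n d ∣       ≡⟨ ∣p*q∣≡∣p∣*∣q∣ ((- 1ℚ) ^ n) (leibnizTail n d) ⟩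
  ∣ (- 1ℚ) ^ n ∣ * ∣ leibnizTail n d ∣   ≡⟨ cong (_* ∣ leibnizTail n d ∣) (∣sign∣ n) ⟩
  1ℚ * ∣ leibnizTail n d ∣               ≡⟨ *-identityˡ ∣ leibnizTail n d ∣ ⟩
  ∣ leibnizTail n d ∣                    ≡⟨ 0≤p⇒∣p∣≡p (proj₁ (leibnizTail-bounds n d)) ⟩
  leibnizTail n d                        ≤⟨ proj₂ (leibnizTail-bounds n d) ⟩
  leibnizTerm n                          ∎
  where open ≤-Reasoning

leibnizTerm-small : ∀ q → leibnizTerm (2 ℕ.* suc q) < + 1 / suc q
leibnizTerm-small q = toℚᵘ-cancel-< (begin-strict
  toℚᵘ (leibnizTerm (2 ℕ.* suc q))   ≃⟨ toℚᵘ-fromℚᵘ (ℚᵘ.mkℚᵘ (+ 4) k) ⟩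
  ℚᵘ.mkℚᵘ (+ 4) k                    <⟨ ℚᵘ.*<* (ℤ.+<+ lemma) ⟩
  ℚᵘ.mkℚᵘ (+ 1) q                    ≃⟨ toℚᵘ-fromℚᵘ (ℚᵘ.mkℚᵘ (+ 1) q) ⟨
  toℚᵘ (+ 1 / suc q)                     ∎)
  where
    import Data.Rational.Unnormalised.Properties as ℚᵘP
    open ℚᵘP.≤-Reasoning
    k = 2 ℕ.* (2 ℕ.* suc q)
    lemma : 4 ℕ.* suc q ℕ.< 1 ℕ.* suc k
    lemma = ℕ.≤-reflexive (trans (cong suc (ℕ.*-assoc 2 2 (suc q))) (sym (ℕ.*-identityˡ (suc k))))

leibniz-cauchy : IsCauchy leibniz
leibniz-cauchy ε 0<ε with 1/suc-below ε 0<ε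
... | q , q≤ε = N , λ m n hm hn → bound m n hm hn (ℕ.≤-total m n)
  where
    N = 2 ℕ.* suc q
    close : ∀ m n → N ℕ.≤ m → m ℕ.≤ n → ∣ leibniz n - leibniz m ∣ < ε
    close m n hm m≤n = begin-strict
      ∣ leibniz n - leibniz m ∣
        ≡⟨ cong (λ k → ∣ leibniz k - leibniz m ∣) (ℕ.m+[n∸m]≡n m≤n) ⟨
      ∣ leibniz (m ℕ.+ (n ℕ.∸ m)) - leibniz m ∣
        ≤⟨ leibniz-close m (n ℕ.∸ m) ⟩
      leibnizTerm m
        ≤⟨ leibnizTerm-anti hm ⟩
      leibnizTerm N
        <⟨ leibnizTerm-small q ⟩
      + 1 / suc q
        ≤⟨ q≤ε ⟩
      ε   ∎
      where open ≤-Reasoning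
    bound : ∀ m n → N ℕ.≤ m → N ℕ.≤ n → _ → ∣ leibniz m - leibniz n ∣ < ε
    bound m n hm hn (inj₁ m≤n) =
      subst (_< ε) (∣-∣-sym (leibniz n) (leibniz m)) (close m n hm m≤n)
    bound m n hm hn (inj₂ n≤m) = close n m hn n≤m

-- Leibniz: π = 4 − 4/3 + 4/5 − 4/7 + ⋯
π : ℝ
π = mkℝ leibniz leibniz-cauchy

shiftedFactorial : ℚ → ℕ → ℚ
shiftedFactorial x zero    = 1ℚ
shiftedFactorial x (suc n) = shiftedFactorial x n * (x + + n / 1)

H⁽²⁾ : ℕ → ℚ
H⁽²⁾ n = ∑ n (λ i → let j = suc i in + 1 / (j ℕ.* j))

shiftedFactorial-pos : ∀ x .{{_ : Positive x}} n → Positive (shiftedFactorial x n)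
shiftedFactorial-pos x zero    = _
shiftedFactorial-pos x (suc n) =
  pos*pos⇒pos (shiftedFactorial x n) {{shiftedFactorial-pos x n}}
    (x + + n / 1) {{pos+nonNeg⇒pos x (+ n / 1) {{normalize-nonNeg n 1}}}}

^-pos : ∀ x .{{_ : Positive x}} n → Positive (x ^ n)
^-pos x zero    = _
^-pos x (suc n) = pos*pos⇒pos x (x ^ n) {{^-pos x n}}

denominator : ℕ → ℚ
denominator k = shiftedFactorial (+ 3 / 2) k ^ 3 * (+ 4 / 1) ^ k

denominator-nonZero : ∀ k → NonZero (denominator k)
denominator-nonZero k = pos⇒nonZero (denominator k)
  {{pos*pos⇒pos (shiftedFactorial (+ 3 / 2) k ^ 3)
      {{^-pos (shiftedFactorial (+ 3 / 2) k) {{shiftedFactorial-pos (+ 3 / 2) k}} 3}}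
    ((+ 4 / 1) ^ k) {{^-pos (+ 4 / 1) k}}}}

seriesTerm : ℕ → ℚ
seriesTerm k =
    (+ (3 ℕ.* k ℕ.+ 2) / 1)
  * (shiftedFactorial 1ℚ k ^ 3 ÷ denominator k) {{denominator-nonZero k}}
  * (H⁽²⁾ (2 ℕ.* k ℕ.+ 1) - + 5 / 4 * H⁽²⁾ k)

module Submission where

-- Expanding in x², the series is the coefficient of x² in
--   Σ_k (3k+2) (1)_k (1-x)_k (1+x)_k / ((3/2)_k ((3-x)/2)_k ((3+x)/2)_k 4^k (1-x²)) = 2 Σ_n 1/((2n+1)²-x²),
-- an identity with a WZ pair.  Only the x²-coefficient of the pair is used: summed over an N × N square, it
-- gives Σ_{k<N} seriesTerm k = 2 Σ_{n<N} 1/(2n+1)⁴ up to O(1/N).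
--
-- It remains to see that Σ 1/(2n+1)⁴ = π⁴/96.  Put t₁ = Σ (-1)ⁿ/(2n+1) = π/4, t₂ = Σ 1/(2n+1)² and
-- t₄ = Σ 1/(2n+1)⁴.  Expanding the partial sums of t₁² and t₂² as double sums and resolving the off-diagonal
-- products into partial fractions, the inner sums telescope and yield 2t₁² = t₂ + R and 2t₂² = 3t₄ + Q.
-- These are exact finite identities, provable by induction on N, whose remainders R and Q are bounded by
-- Σ_{i<N} 1/((2i+1)(N-i)) = O(log N / N).

open import Defs
open import Data.Integer.Base as ℤ using (+_)
import Data.Integer.Properties as ℤ
open import Data.Nat.Base as ℕ using (ℕ; zero; suc)
import Data.Nat.Properties as ℕ
open import Data.Product.Base using (∃-syntax; _×_; _,_; proj₁; proj₂)
open import Data.Rational.Base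
open import Data.Rational.Properties
open import Data.Rational.Solver using (module +-*-Solver)
import Data.Rational.Unnormalised.Base as ℚᵘ
import Data.Rational.Unnormalised.Properties as ℚᵘ
open import Data.Sum.Base using (inj₁; inj₂)
open import Function.Base using (_∘_)
open import Relation.Binary.PropositionalEquality
  using (_≡_; refl; sym; trans; cong; cong₂; subst; subst₂; module ≡-Reasoning)
open +-*-Solver using (solve; _:+_; _:*_; _:-_; :-_; _:=_; con)

-- Rational arithmetic and finite sums

2ℚ 3ℚ 4ℚ ¼ : ℚ
2ℚ = 1ℚ + 1ℚ
3ℚ = 1ℚ + 2ℚ
4ℚ = 2ℚ + 2ℚ
¼  = ½ * ½

/-homo-* : ∀ i j m n → i / suc m * (j / suc n) ≡ (i ℤ.* j) / (suc m ℕ.* suc n)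
/-homo-* i j m n = toℚᵘ-injective (begin
  toℚᵘ (i / suc m * (j / suc n))           ≈⟨ toℚᵘ-homo-* (i / suc m) (j / suc n) ⟩
  toℚᵘ (i / suc m) ℚᵘ.* toℚᵘ (j / suc n)   ≈⟨ ℚᵘ.*-cong (toℚᵘ-fromℚᵘ (ℚᵘ.mkℚᵘ i m)) (toℚᵘ-fromℚᵘ (ℚᵘ.mkℚᵘ j n)) ⟩
  ℚᵘ.mkℚᵘ i m ℚᵘ.* ℚᵘ.mkℚᵘ j n             ≈⟨ toℚᵘ-fromℚᵘ (ℚᵘ.mkℚᵘ i m ℚᵘ.* ℚᵘ.mkℚᵘ j n) ⟨
  toℚᵘ ((i ℤ.* j) / (suc m ℕ.* suc n))     ∎)
  where open import Relation.Binary.Reasoning.Setoid ℚᵘ.≃-setoid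

/1-homo-+ : ∀ i j → i / 1 + j / 1 ≡ (i ℤ.+ j) / 1
/1-homo-+ i j = toℚᵘ-injective (begin
  toℚᵘ (i / 1 + j / 1)              ≈⟨ toℚᵘ-homo-+ (i / 1) (j / 1) ⟩
  toℚᵘ (i / 1) ℚᵘ.+ toℚᵘ (j / 1)    ≈⟨ ℚᵘ.+-cong (toℚᵘ-fromℚᵘ (ℚᵘ.mkℚᵘ i 0)) (toℚᵘ-fromℚᵘ (ℚᵘ.mkℚᵘ j 0)) ⟩
  ℚᵘ.mkℚᵘ i 0 ℚᵘ.+ ℚᵘ.mkℚᵘ j 0      ≡⟨ cong (λ k → ℚᵘ.mkℚᵘ k 0) (cong₂ ℤ._+_ (ℤ.*-identityʳ i) (ℤ.*-identityʳ j)) ⟩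
  ℚᵘ.mkℚᵘ (i ℤ.+ j) 0               ≈⟨ toℚᵘ-fromℚᵘ (ℚᵘ.mkℚᵘ (i ℤ.+ j) 0) ⟨
  toℚᵘ ((i ℤ.+ j) / 1)              ∎)
  where open import Relation.Binary.Reasoning.Setoid ℚᵘ.≃-setoid

-- Kept abstract so that comparing terms never unfolds the gcd normalisation of _/_.
abstract
  ι : ℕ → ℚ
  ι n = + n / 1

  h : ℕ → ℚ
  h n = + 1 / suc n

  ι-def : ∀ n → + n / 1 ≡ ι n
  ι-def n = refl

  h-def : ∀ n → + 1 / suc n ≡ h n
  h-def n = refl

  ι-zero : ι 0 ≡ 0ℚ
  ι-zero = refl

  ι-one : ι 1 ≡ 1ℚ
  ι-one = refl

  ι-+ : ∀ m n → ι (m ℕ.+ n) ≡ ι m + ι n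
  ι-+ m n = sym (/1-homo-+ (+ m) (+ n))

  ι-* : ∀ m n → ι (m ℕ.* n) ≡ ι m * ι n
  ι-* m n = trans (cong (_/ 1) (ℤ.pos-* m n)) (sym (/-homo-* (+ m) (+ n) 0 0))

  /-split : ∀ m n → + m / suc n ≡ ι m * h n
  /-split m n = sym (trans (/-homo-* (+ m) (+ 1) 0 n)
    (/-cong (ℤ.*-identityʳ (+ m)) (ℕ.+-identityʳ (suc n))))

  ι*h : ∀ n → ι (suc n) * h n ≡ 1ℚ
  ι*h n = trans (sym (/-split (suc n) n)) (n/n≡1 n)
    where
    n/n≡1 : ∀ n → + suc n / suc n ≡ 1ℚ
    n/n≡1 n = toℚᵘ-injective (ℚᵘ.≃-trans (toℚᵘ-fromℚᵘ (ℚᵘ.mkℚᵘ (+ suc n) n))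
      (ℚᵘ.*≡* (ℤ.*-comm (+ suc n) (+ 1))))

  h-* : ∀ m n → h m * h n ≡ h (n ℕ.+ m ℕ.* suc n)
  h-* m n = /-homo-* (+ 1) (+ 1) m n

  0≤ι : ∀ n → 0ℚ ≤ ι n
  0≤ι n = nonNegative⁻¹ (+ n / 1) {{normalize-nonNeg n 1}}

  0<h : ∀ n → 0ℚ < h n
  0<h n = positive⁻¹ (+ 1 / suc n) {{normalize-pos 1 (suc n)}}

ι-suc : ∀ n → ι (suc n) ≡ 1ℚ + ι n
ι-suc n = trans (ι-+ 1 n) (cong (_+ ι n) ι-one)

ι-two : ι 2 ≡ 2ℚ
ι-two = trans (ι-suc 1) (cong (_+_ 1ℚ) ι-one)

ι*h′ : ∀ n → (1ℚ + ι n) * h n ≡ 1ℚ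
ι*h′ n = trans (cong (_* h n) (sym (ι-suc n))) (ι*h n)

0≤1 : 0ℚ ≤ 1ℚ
0≤1 = nonNegative⁻¹ 1ℚ

0≤h : ∀ n → 0ℚ ≤ h n
0≤h n = <⇒≤ (0<h n)

0≤+ : ∀ {p q} → 0ℚ ≤ p → 0ℚ ≤ q → 0ℚ ≤ p + q
0≤+ = +-mono-≤

*-mono-≤ : ∀ {p q r s} → 0ℚ ≤ p → p ≤ q → 0ℚ ≤ r → r ≤ s → p * r ≤ q * s
*-mono-≤ {p} {q} {r} {s} 0≤p p≤q 0≤r r≤s = ≤-trans
  (*-monoʳ-≤-nonNeg r {{nonNegative 0≤r}} p≤q)
  (*-monoˡ-≤-nonNeg q {{nonNegative (≤-trans 0≤p p≤q)}} r≤s)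

0≤* : ∀ {p q} → 0ℚ ≤ p → 0ℚ ≤ q → 0ℚ ≤ p * q
0≤* {p} {q} 0≤p 0≤q = subst (_≤ p * q) (*-zeroˡ q) (*-mono-≤ ≤-refl 0≤p 0≤q ≤-refl)

-- Reduces an inequality between polynomial expressions to an identity for the ring solver, once the
-- difference is displayed as a sum of nonnegative terms.
≤-from-difference : ∀ {p q r} → 0ℚ ≤ r → q ≡ p + r → p ≤ q
≤-from-difference {p} 0≤r e = subst₂ _≤_ (+-identityʳ p) (sym e) (+-monoʳ-≤ p 0≤r)

∑-cong : ∀ n {f g : ℕ → ℚ} → (∀ i → i ℕ.< n → f i ≡ g i) → ∑ n f ≡ ∑ n g
∑-cong zero    e = refl
∑-cong (suc n) e = cong₂ _+_ (∑-cong n (λ i i<n → e i (ℕ.m<n⇒m<1+n i<n))) (e n ℕ.≤-refl)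

∑-+ : ∀ n f g → ∑ n (λ i → f i + g i) ≡ ∑ n f + ∑ n g
∑-+ zero    f g = refl
∑-+ (suc n) f g = trans (cong (_+ (f n + g n)) (∑-+ n f g))
  (solve 4 (λ a b c d → (a :+ b) :+ (c :+ d) := (a :+ c) :+ (b :+ d)) refl (∑ n f) (∑ n g) (f n) (g n))

∑-* : ∀ n c f → ∑ n (λ i → c * f i) ≡ c * ∑ n f
∑-* zero    c f = sym (*-zeroʳ c)
∑-* (suc n) c f = trans (cong (_+ c * f n) (∑-* n c f)) (sym (*-distribˡ-+ c (∑ n f) (f n)))

∑-mono : ∀ n {f g : ℕ → ℚ} → (∀ i → i ℕ.< n → f i ≤ g i) → ∑ n f ≤ ∑ n g
∑-mono zero    e = ≤-refl
∑-mono (suc n) e = +-mono-≤ (∑-mono n (λ i i<n → e i (ℕ.m<n⇒m<1+n i<n))) (e n ℕ.≤-refl)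

∑-nonNeg : ∀ n {f : ℕ → ℚ} → (∀ i → 0ℚ ≤ f i) → 0ℚ ≤ ∑ n f
∑-nonNeg zero    e = ≤-refl
∑-nonNeg (suc n) e = 0≤+ (∑-nonNeg n e) (e n)

∣∑∣≤ : ∀ n {f g : ℕ → ℚ} → (∀ i → i ℕ.< n → ∣ f i ∣ ≤ g i) → ∣ ∑ n f ∣ ≤ ∑ n g
∣∑∣≤ zero    e = ≤-refl
∣∑∣≤ (suc n) {f} e = ≤-trans (∣p+q∣≤∣p∣+∣q∣ (∑ n f) (f n))
  (+-mono-≤ (∣∑∣≤ n (λ i i<n → e i (ℕ.m<n⇒m<1+n i<n))) (e n ℕ.≤-refl))

∑-split : ∀ m n f → ∑ (m ℕ.+ n) f ≡ ∑ m f + ∑ n (λ i → f (m ℕ.+ i))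
∑-split m zero    f = trans (cong (λ k → ∑ k f) (ℕ.+-identityʳ m)) (sym (+-identityʳ (∑ m f)))
∑-split m (suc n) f = begin
  ∑ (m ℕ.+ suc n) f                                        ≡⟨ cong (λ k → ∑ k f) (ℕ.+-suc m n) ⟩
  ∑ (m ℕ.+ n) f + f (m ℕ.+ n)                              ≡⟨ cong (_+ f (m ℕ.+ n)) (∑-split m n f) ⟩
  (∑ m f + ∑ n (λ i → f (m ℕ.+ i))) + f (m ℕ.+ n)          ≡⟨ +-assoc (∑ m f) _ _ ⟩
  ∑ m f + ∑ (suc n) (λ i → f (m ℕ.+ i))                    ∎
  where open ≡-Reasoning

∑-first : ∀ n f → ∑ (suc n) f ≡ f 0 + ∑ n (f ∘ suc)
∑-first n f = trans (∑-split 1 n f) (cong (_+ ∑ n (f ∘ suc)) (+-identityˡ (f 0)))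

∑-reverse : ∀ n f → ∑ n (λ i → f (n ℕ.∸ suc i)) ≡ ∑ n f
∑-reverse zero    f = refl
∑-reverse (suc n) f = begin
  ∑ (suc n) (λ i → f (n ℕ.∸ i))          ≡⟨ ∑-first n (λ i → f (n ℕ.∸ i)) ⟩
  f n + ∑ n (λ i → f (n ℕ.∸ suc i))      ≡⟨ cong (λ p → f n + p) (∑-reverse n f) ⟩
  f n + ∑ n f                            ≡⟨ +-comm (f n) (∑ n f) ⟩
  ∑ (suc n) f                            ∎
  where open ≡-Reasoning

-- Partial fractions for the sums over odd numbers

-- Since `h n` is 1/(n + 1), `o i` is 1/(2i + 1), and `a j` = (-1)^(j+1)/(j + 1) are the terms of
-- the series for -log 2.
o s a : ℕ → ℚ
o i = h (2 ℕ.* i)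
s i = (- 1ℚ) ^ i
a j = s (suc j) * h j

ι-odd : ∀ i → ι (suc (2 ℕ.* i)) ≡ 1ℚ + 2ℚ * ι i
ι-odd i = trans (ι-suc (2 ℕ.* i)) (cong (_+_ 1ℚ) (trans (ι-* 2 i)
  (cong (_* ι i) ι-two)))

ι*o : ∀ i → (1ℚ + 2ℚ * ι i) * o i ≡ 1ℚ
ι*o i = trans (cong (_* o i) (sym (ι-odd i))) (ι*h (2 ℕ.* i))

s-+ : ∀ m n → s (m ℕ.+ n) ≡ s m * s n
s-+ zero    n = sym (*-identityˡ (s n))
s-+ (suc m) n = trans (cong (- 1ℚ *_) (s-+ m n)) (sym (*-assoc (- 1ℚ) (s m) (s n)))

s² : ∀ i → s i * s i ≡ 1ℚ
s² zero    = refl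
s² (suc i) = trans (solve 1 (λ x → (con (- 1ℚ) :* x) :* (con (- 1ℚ) :* x) := x :* x) refl (s i)) (s² i)

-- Multiply by `z * z'` = 1 and expand `z`. Reciprocals enter only through product equations, so
-- every rearrangement is polynomial.
partial-fractions : ∀ {x y z x' y' z'} α β → x * x' ≡ 1ℚ → y * y' ≡ 1ℚ → z * z' ≡ 1ℚ →
  z ≡ α * x + β * y → x' * y' ≡ z' * (α * y' + β * x')
partial-fractions {x} {y} {z} {x'} {y'} {z'} α β xx' yy' zz' e = begin
  x' * y'                                             ≡⟨ *-identityˡ (x' * y') ⟨
  1ℚ * (x' * y')                                      ≡⟨ cong (_* (x' * y')) zz' ⟨
  z * z' * (x' * y')                                  ≡⟨ cong (λ w → w * z' * (x' * y')) e ⟩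
  (α * x + β * y) * z' * (x' * y')                    ≡⟨ rearrange α β x y x' y' z' ⟩
  z' * (α * (x * x') * y' + β * (y * y') * x')        ≡⟨ cong₂ (λ p q → z' * (α * p * y' + β * q * x')) xx' yy' ⟩
  z' * (α * 1ℚ * y' + β * 1ℚ * x')                    ≡⟨ cong₂ (λ p q → z' * (p * y' + q * x')) (*-identityʳ α) (*-identityʳ β) ⟩
  z' * (α * y' + β * x')                              ∎
  where
  open ≡-Reasoning
  rearrange : ∀ α β x y x' y' z' →
    (α * x + β * y) * z' * (x' * y') ≡ z' * (α * (x * x') * y' + β * (y * y') * x')
  rearrange = solve 7 (λ α β x y x' y' z' →
    (α :* x :+ β :* y) :* z' :* (x' :* y') := z' :* (α :* (x :* x') :* y' :+ β :* (y :* y') :* x')) refl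

ι-sum : ∀ m i → ι (m ℕ.+ suc i) ≡ ι m + (1ℚ + ι i)
ι-sum m i = trans (ι-+ m (suc i)) (cong (_+_ (ι m)) (ι-suc i))

-- For i < N the number `m` is N - 1 - i; taking `m` and `i` as parameters avoids truncated
-- subtraction. Here `h m` = 1/(N - i) and `h (N ℕ.+ i)` = 1/(N + i + 1), and the partial fractions
-- rest on 2N + 1 = 2(N - i) + (2i + 1) = 2(N + i + 1) - (2i + 1).
module _ (m i : ℕ) where
  private
    N = m ℕ.+ suc i

    ιY : 1ℚ + ι (N ℕ.+ i) ≡ 1ℚ + (ι m + (1ℚ + ι i) + ι i)
    ιY = cong (_+_ 1ℚ) (trans (ι-+ N i) (cong (_+ ι i) (ι-sum m i)))

  h*o-near : h m * o i ≡ o N * (2ℚ * o i + 1ℚ * h m)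
  h*o-near = partial-fractions {1ℚ + ι m} {1ℚ + 2ℚ * ι i} {1ℚ + 2ℚ * ι N} 2ℚ 1ℚ (ι*h′ m) (ι*o i) (ι*o N)
    (trans (cong (λ x → 1ℚ + 2ℚ * x) (ι-sum m i))
      (solve 2 (λ m i → con 1ℚ :+ con 2ℚ :* (m :+ (con 1ℚ :+ i))
        := con 2ℚ :* (con 1ℚ :+ m) :+ con 1ℚ :* (con 1ℚ :+ con 2ℚ :* i)) refl (ι m) (ι i)))

  h*o-far : h (N ℕ.+ i) * o i ≡ o N * (2ℚ * o i + (- 1ℚ) * h (N ℕ.+ i))
  h*o-far = partial-fractions {1ℚ + ι (N ℕ.+ i)} {1ℚ + 2ℚ * ι i} {1ℚ + 2ℚ * ι N} {h (N ℕ.+ i)} {o i} 2ℚ (- 1ℚ) (ι*h′ (N ℕ.+ i)) (ι*o i) (ι*o N)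
    (trans (cong (λ x → 1ℚ + 2ℚ * x) (ι-sum m i))
      (trans (solve 2 (λ m i → con 1ℚ :+ con 2ℚ :* (m :+ (con 1ℚ :+ i))
          := con 2ℚ :* (con 1ℚ :+ (m :+ (con 1ℚ :+ i) :+ i)) :+ con (- 1ℚ) :* (con 1ℚ :+ con 2ℚ :* i)) refl (ι m) (ι i))
        (cong (λ y → 2ℚ * y + (- 1ℚ) * (1ℚ + 2ℚ * ι i)) (sym ιY))))

  s-far : s (suc (N ℕ.+ i)) ≡ s m
  s-far = begin
    - 1ℚ * s (N ℕ.+ i)                   ≡⟨ cong (- 1ℚ *_) (trans (s-+ N i) (cong (_* s i) (s-+ m (suc i)))) ⟩
    - 1ℚ * (s m * (- 1ℚ * s i) * s i)    ≡⟨ solve 2 (λ x y → con (- 1ℚ) :* (x :* (con (- 1ℚ) :* y) :* y) := x :* (y :* y)) refl (s m) (s i) ⟩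
    s m * (s i * s i)                    ≡⟨ cong (s m *_) (s² i) ⟩
    s m * 1ℚ                             ≡⟨ *-identityʳ (s m) ⟩
    s m                                  ∎
    where open ≡-Reasoning

  s-product : s N * s i ≡ - s m
  s-product = begin
    s N * s i                    ≡⟨ cong (_* s i) (s-+ m (suc i)) ⟩
    s m * (- 1ℚ * s i) * s i     ≡⟨ solve 2 (λ x y → x :* (con (- 1ℚ) :* y) :* y := :- (x :* (y :* y))) refl (s m) (s i) ⟩
    - (s m * (s i * s i))        ≡⟨ cong (λ x → - (s m * x)) (s² i) ⟩
    - (s m * 1ℚ)                 ≡⟨ cong -_ (*-identityʳ (s m)) ⟩
    - s m                        ∎
    where open ≡-Reasoning

  -- The signs in `a m` and `a (N ℕ.+ i)` are opposite, so their difference is, up to sign, a sum of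
  -- two values of `h`, and both partial fractions apply. The term with `4ℚ` is the cross term of
  -- the indices N and i in 2t₁².
  a-step : (a m - a (N ℕ.+ i)) * o i ≡ o N * (4ℚ * s N * (s i * o i) + (a m + a (N ℕ.+ i)))
  a-step = begin
    (- 1ℚ * s m * x - s (suc (N ℕ.+ i)) * y) * o i
      ≡⟨ cong (λ σ → (- 1ℚ * s m * x - σ * y) * o i) s-far ⟩
    (- 1ℚ * s m * x - s m * y) * o i
      ≡⟨ solve 4 (λ σ x y v → (con (- 1ℚ) :* σ :* x :- σ :* y) :* v := :- σ :* (x :* v :+ y :* v)) refl (s m) x y (o i) ⟩
    - s m * (x * o i + y * o i)
      ≡⟨ cong₂ (λ p q → - s m * (p + q)) h*o-near h*o-far ⟩
    - s m * (o N * (2ℚ * o i + 1ℚ * x) + o N * (2ℚ * o i + (- 1ℚ) * y))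
      ≡⟨ solve 5 (λ σ x y v u →
           :- σ :* (u :* (con 2ℚ :* v :+ con 1ℚ :* x) :+ u :* (con 2ℚ :* v :+ con (- 1ℚ) :* y))
           := u :* (con 4ℚ :* (:- σ) :* v :+ (con (- 1ℚ) :* σ :* x :+ σ :* y))) refl (s m) x y (o i) (o N) ⟩
    o N * (4ℚ * (- s m) * o i + (- 1ℚ * s m * x + s m * y))
      ≡⟨ cong₂ (λ p q → o N * (4ℚ * p * o i + (- 1ℚ * s m * x + q * y))) s-product s-far ⟨
    o N * (4ℚ * (s N * s i) * o i + (- 1ℚ * s m * x + s (suc (N ℕ.+ i)) * y))
      ≡⟨ cong (λ p → o N * (p + (a m + a (N ℕ.+ i)))) (solve 4 (λ f p q r → f :* (p :* q) :* r := f :* p :* (q :* r)) refl 4ℚ (s N) (s i) (o i)) ⟩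
    o N * (4ℚ * s N * (s i * o i) + (a m + a (N ℕ.+ i)))   ∎
    where
    open ≡-Reasoning
    x = h m
    y = h (N ℕ.+ i)

  -- With x, y, v, u as below, the partial fractions give (x - y)v = u(x + y) and (x + y)v = u(4v +
  -- (x - y)). Using these alternately, three times in all, consumes the three factors v.
  h-step : (h m - h (N ℕ.+ i)) * (o i * (o i * o i))
         ≡ o N * o N * (4ℚ * (o i * o i) + o N * (h m + h (N ℕ.+ i)))
  h-step = begin
    (x - y) * (v * (v * v))
      ≡⟨ solve 3 (λ x y v → (x :- y) :* (v :* (v :* v)) := (x :* v :- y :* v) :* (v :* v)) refl x y v ⟩
    (x * v - y * v) * (v * v)
      ≡⟨ cong₂ (λ p q → (p - q) * (v * v)) h*o-near h*o-far ⟩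
    (u * (2ℚ * v + 1ℚ * x) - u * (2ℚ * v + (- 1ℚ) * y)) * (v * v)
      ≡⟨ solve 4 (λ x y v u → (u :* (con 2ℚ :* v :+ con 1ℚ :* x) :- u :* (con 2ℚ :* v :+ con (- 1ℚ) :* y)) :* (v :* v)
           := u :* (x :* v :+ y :* v) :* v) refl x y v u ⟩
    u * (x * v + y * v) * v
      ≡⟨ cong₂ (λ p q → u * (p + q) * v) h*o-near h*o-far ⟩
    u * (u * (2ℚ * v + 1ℚ * x) + u * (2ℚ * v + (- 1ℚ) * y)) * v
      ≡⟨ solve 4 (λ x y v u → u :* (u :* (con 2ℚ :* v :+ con 1ℚ :* x) :+ u :* (con 2ℚ :* v :+ con (- 1ℚ) :* y)) :* v
           := u :* u :* (con 4ℚ :* (v :* v) :+ (x :* v :- y :* v))) refl x y v u ⟩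
    u * u * (4ℚ * (v * v) + (x * v - y * v))
      ≡⟨ cong₂ (λ p q → u * u * (4ℚ * (v * v) + (p - q))) h*o-near h*o-far ⟩
    u * u * (4ℚ * (v * v) + (u * (2ℚ * v + 1ℚ * x) - u * (2ℚ * v + (- 1ℚ) * y)))
      ≡⟨ solve 4 (λ x y v u → u :* u :* (con 4ℚ :* (v :* v) :+ (u :* (con 2ℚ :* v :+ con 1ℚ :* x) :- u :* (con 2ℚ :* v :+ con (- 1ℚ) :* y)))
           := u :* u :* (con 4ℚ :* (v :* v) :+ u :* (x :+ y))) refl x y v u ⟩
    u * u * (4ℚ * (v * v) + u * (x + y))   ∎
    where
    open ≡-Reasoning
    x = h m
    y = h (N ℕ.+ i)
    v = o i
    u = o N

-- Finite identities for the squares of `t₁` and `t₂`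

t₁ t₂ t₄ : ℕ → ℚ
t₁ n = ∑ n (λ i → s i * o i)
t₂ n = ∑ n (λ i → o i * o i)
t₄ n = ∑ n (λ i → o i * o i * (o i * o i))

-- R = window a o and Q = window h o³ are the remainders of the identities for 2t₁² and 2t₂².
window : (c w : ℕ → ℚ) → ℕ → ℚ
window c w N = ∑ N (λ i → (∑ (N ℕ.∸ suc i) c - ∑ (N ℕ.+ i) c) * w i)

∑-window : ∀ (c : ℕ → ℚ) N → ∑ N (λ i → c (N ℕ.∸ suc i) + c (N ℕ.+ i)) ≡ ∑ (N ℕ.+ N) c
∑-window c N = begin
  ∑ N (λ i → c (N ℕ.∸ suc i) + c (N ℕ.+ i))               ≡⟨ ∑-+ N (λ i → c (N ℕ.∸ suc i)) (λ i → c (N ℕ.+ i)) ⟩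
  ∑ N (λ i → c (N ℕ.∸ suc i)) + ∑ N (λ i → c (N ℕ.+ i))   ≡⟨ cong (_+ ∑ N (λ i → c (N ℕ.+ i))) (∑-reverse N c) ⟩
  ∑ N c + ∑ N (λ i → c (N ℕ.+ i))                         ≡⟨ ∑-split N N c ⟨
  ∑ (N ℕ.+ N) c                                           ∎
  where open ≡-Reasoning

-- When N grows by one, both prefix sums in each old summand gain one term. In the new summand i = N
-- the first prefix is empty, which leaves only the negative boundary term.
window-suc : ∀ c w N → window c w (suc N)
  ≡ window c w N + (∑ N (λ i → (c (N ℕ.∸ suc i) - c (N ℕ.+ i)) * w i) - ∑ (suc (N ℕ.+ N)) c * w N)
window-suc c w N = begin
  ∑ N (λ i → (∑ (N ℕ.∸ i) c - ∑ (suc (N ℕ.+ i)) c) * w i) + (∑ (N ℕ.∸ N) c - ∑ (suc (N ℕ.+ N)) c) * w N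
    ≡⟨ cong₂ _+_ (trans (∑-cong N step) (∑-+ N _ _))
         (trans (cong (λ k → (∑ k c - ∑ (suc (N ℕ.+ N)) c) * w N) (ℕ.n∸n≡0 N))
           (solve 2 (λ x y → (con 0ℚ :- x) :* y := :- (x :* y)) refl (∑ (suc (N ℕ.+ N)) c) (w N))) ⟩
  (window c w N + ∑ N (λ i → (c (N ℕ.∸ suc i) - c (N ℕ.+ i)) * w i)) + - (∑ (suc (N ℕ.+ N)) c * w N)
    ≡⟨ +-assoc (window c w N) _ _ ⟩
  window c w N + (∑ N (λ i → (c (N ℕ.∸ suc i) - c (N ℕ.+ i)) * w i) - ∑ (suc (N ℕ.+ N)) c * w N)   ∎
  where
  open ≡-Reasoning
  step : ∀ i → i ℕ.< N → (∑ (N ℕ.∸ i) c - ∑ (suc (N ℕ.+ i)) c) * w i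
    ≡ (∑ (N ℕ.∸ suc i) c - ∑ (N ℕ.+ i) c) * w i + (c (N ℕ.∸ suc i) - c (N ℕ.+ i)) * w i
  step i i<N = trans (cong (λ k → (∑ k c - ∑ (suc (N ℕ.+ i)) c) * w i) (ℕ.+-∸-assoc 1 i<N))
    (solve 5 (λ x y u v w → ((x :+ u) :- (y :+ v)) :* w := (x :- y) :* w :+ (u :- v) :* w) refl
      (∑ (N ℕ.∸ suc i) c) (∑ (N ℕ.+ i) c) (c (N ℕ.∸ suc i)) (c (N ℕ.+ i)) (w i))

o-double : ∀ N → h (N ℕ.+ N) ≡ o N
o-double N = cong (λ k → h (N ℕ.+ k)) (sym (ℕ.+-identityʳ N))

-- In the induction step `u * ∑ (N ℕ.+ N) a` cancels against the boundary term of `window-suc`. As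
-- `a (N ℕ.+ N)` is `- u`, that boundary also leaves `u * u`, so the new 2u² is shared equally
-- between `t₂` and the window.
2t₁²≡t₂+window : ∀ N → 2ℚ * (t₁ N * t₁ N) ≡ t₂ N + window a o N
2t₁²≡t₂+window zero    = refl
2t₁²≡t₂+window (suc N) = begin
  2ℚ * ((t + σ * u) * (t + σ * u))
    ≡⟨ solve 3 (λ t σ u → con 2ℚ :* ((t :+ σ :* u) :* (t :+ σ :* u))
         := con 2ℚ :* (t :* t) :+ con 4ℚ :* σ :* t :* u :+ con 2ℚ :* (σ :* σ) :* (u :* u)) refl t σ u ⟩
  2ℚ * (t * t) + 4ℚ * σ * t * u + 2ℚ * (σ * σ) * (u * u)
    ≡⟨ cong₂ (λ p q → p + 4ℚ * σ * t * u + 2ℚ * q * (u * u)) (2t₁²≡t₂+window N) (s² N) ⟩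
  t₂ N + window a o N + 4ℚ * σ * t * u + 2ℚ * 1ℚ * (u * u)
    ≡⟨ solve 6 (λ b w σ t u c → b :+ w :+ con 4ℚ :* σ :* t :* u :+ con 2ℚ :* con 1ℚ :* (u :* u)
         := b :+ u :* u :+ (w :+ (u :* (con 4ℚ :* σ :* t :+ c) :- (c :- u) :* u))) refl
         (t₂ N) (window a o N) σ t u (∑ (N ℕ.+ N) a) ⟩
  t₂ N + u * u + (window a o N + (u * (4ℚ * σ * t + ∑ (N ℕ.+ N) a) - (∑ (N ℕ.+ N) a - u) * u))
    ≡⟨ cong₂ (λ p q → t₂ N + u * u + (window a o N + (p - (∑ (N ℕ.+ N) a + q) * u))) sum-step a-last ⟨
  t₂ (suc N) + (window a o N + (∑ N (λ i → (a (N ℕ.∸ suc i) - a (N ℕ.+ i)) * o i) - ∑ (suc (N ℕ.+ N)) a * o N))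
    ≡⟨ cong (λ w → t₂ (suc N) + w) (window-suc a o N) ⟨
  t₂ (suc N) + window a o (suc N)   ∎
  where
  open ≡-Reasoning
  t = t₁ N
  σ = s N
  u = o N
  a-last : a (N ℕ.+ N) ≡ - u
  a-last = begin
    - 1ℚ * s (N ℕ.+ N) * h (N ℕ.+ N)   ≡⟨ cong₂ (λ p q → - 1ℚ * p * q) (trans (s-+ N N) (s² N)) (o-double N) ⟩
    - 1ℚ * 1ℚ * u                      ≡⟨ solve 1 (λ u → con (- 1ℚ) :* con 1ℚ :* u := :- u) refl u ⟩
    - u                                ∎
  sum-step : ∑ N (λ i → (a (N ℕ.∸ suc i) - a (N ℕ.+ i)) * o i) ≡ u * (4ℚ * σ * t + ∑ (N ℕ.+ N) a)
  sum-step = begin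
    ∑ N (λ i → (a (N ℕ.∸ suc i) - a (N ℕ.+ i)) * o i)
      ≡⟨ ∑-cong N (λ i i<N → subst (λ M → (a (N ℕ.∸ suc i) - a (M ℕ.+ i)) * o i
             ≡ o M * (4ℚ * s M * (s i * o i) + (a (N ℕ.∸ suc i) + a (M ℕ.+ i))))
           (ℕ.m∸n+n≡m i<N) (a-step (N ℕ.∸ suc i) i)) ⟩
    ∑ N (λ i → u * (4ℚ * σ * (s i * o i) + (a (N ℕ.∸ suc i) + a (N ℕ.+ i))))
      ≡⟨ ∑-* N u _ ⟩
    u * ∑ N (λ i → 4ℚ * σ * (s i * o i) + (a (N ℕ.∸ suc i) + a (N ℕ.+ i)))
      ≡⟨ cong (u *_) (trans (∑-+ N _ _) (cong₂ _+_ (∑-* N (4ℚ * σ) _) (∑-window a N))) ⟩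
    u * (4ℚ * σ * t + ∑ (N ℕ.+ N) a)   ∎

o³ : ℕ → ℚ
o³ i = o i * (o i * o i)

-- The same cancellation, except that `h (N ℕ.+ N)` is `+ u`: the boundary leaves -u⁴, and 2u⁴ = 3u⁴
-- - u⁴ explains the coefficient 3.
2t₂²≡3t₄+window : ∀ N → 2ℚ * (t₂ N * t₂ N) ≡ 3ℚ * t₄ N + window h o³ N
2t₂²≡3t₄+window zero    = refl
2t₂²≡3t₄+window (suc N) = begin
  2ℚ * ((t + u * u) * (t + u * u))
    ≡⟨ solve 2 (λ t u → con 2ℚ :* ((t :+ u :* u) :* (t :+ u :* u))
         := con 2ℚ :* (t :* t) :+ con 4ℚ :* t :* (u :* u) :+ con 2ℚ :* (u :* u :* (u :* u))) refl t u ⟩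
  2ℚ * (t * t) + 4ℚ * t * (u * u) + 2ℚ * (u * u * (u * u))
    ≡⟨ cong (λ p → p + 4ℚ * t * (u * u) + 2ℚ * (u * u * (u * u))) (2t₂²≡3t₄+window N) ⟩
  3ℚ * t₄ N + window h o³ N + 4ℚ * t * (u * u) + 2ℚ * (u * u * (u * u))
    ≡⟨ solve 5 (λ b w t u c → con 3ℚ :* b :+ w :+ con 4ℚ :* t :* (u :* u) :+ con 2ℚ :* (u :* u :* (u :* u))
         := con 3ℚ :* (b :+ u :* u :* (u :* u)) :+ (w :+ (u :* u :* (con 4ℚ :* t :+ u :* c) :- (c :+ u) :* (u :* (u :* u))))) refl
         (t₄ N) (window h o³ N) t u (∑ (N ℕ.+ N) h) ⟩
  3ℚ * t₄ (suc N) + (window h o³ N + (u * u * (4ℚ * t + u * ∑ (N ℕ.+ N) h) - (∑ (N ℕ.+ N) h + u) * o³ N))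
    ≡⟨ cong₂ (λ p q → 3ℚ * t₄ (suc N) + (window h o³ N + (p - (∑ (N ℕ.+ N) h + q) * o³ N))) sum-step (o-double N) ⟨
  3ℚ * t₄ (suc N) + (window h o³ N + (∑ N (λ i → (h (N ℕ.∸ suc i) - h (N ℕ.+ i)) * o³ i) - ∑ (suc (N ℕ.+ N)) h * o³ N))
    ≡⟨ cong (λ w → 3ℚ * t₄ (suc N) + w) (window-suc h o³ N) ⟨
  3ℚ * t₄ (suc N) + window h o³ (suc N)   ∎
  where
  open ≡-Reasoning
  t = t₂ N
  u = o N
  sum-step : ∑ N (λ i → (h (N ℕ.∸ suc i) - h (N ℕ.+ i)) * o³ i) ≡ u * u * (4ℚ * t + u * ∑ (N ℕ.+ N) h)
  sum-step = begin
    ∑ N (λ i → (h (N ℕ.∸ suc i) - h (N ℕ.+ i)) * o³ i)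
      ≡⟨ ∑-cong N (λ i i<N → subst (λ M → (h (N ℕ.∸ suc i) - h (M ℕ.+ i)) * o³ i
             ≡ o M * o M * (4ℚ * (o i * o i) + o M * (h (N ℕ.∸ suc i) + h (M ℕ.+ i))))
           (ℕ.m∸n+n≡m i<N) (h-step (N ℕ.∸ suc i) i)) ⟩
    ∑ N (λ i → u * u * (4ℚ * (o i * o i) + u * (h (N ℕ.∸ suc i) + h (N ℕ.+ i))))
      ≡⟨ ∑-* N (u * u) _ ⟩
    u * u * ∑ N (λ i → 4ℚ * (o i * o i) + u * (h (N ℕ.∸ suc i) + h (N ℕ.+ i)))
      ≡⟨ cong (u * u *_) (trans (∑-+ N _ _) (cong₂ _+_ (∑-* N 4ℚ _) (trans (∑-* N u _) (cong (u *_) (∑-window h N))))) ⟩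
    u * u * (4ℚ * t + u * ∑ (N ℕ.+ N) h)   ∎

-- Estimates for the remainders

ι-mono : ∀ {m n} → m ℕ.≤ n → ι m ≤ ι n
ι-mono {m} {n} m≤n = ≤-from-difference (0≤ι (n ℕ.∸ m))
  (trans (cong ι (sym (ℕ.m+[n∸m]≡n m≤n))) (ι-+ m (n ℕ.∸ m)))

h-anti : ∀ {m n} → m ℕ.≤ n → h n ≤ h m
h-anti {m} {n} m≤n = begin
  h n                          ≡⟨ *-identityˡ (h n) ⟨
  1ℚ * h n                     ≡⟨ cong (_* h n) (ι*h m) ⟨
  ι (suc m) * h m * h n        ≡⟨ *-assoc (ι (suc m)) (h m) (h n) ⟩
  ι (suc m) * (h m * h n)      ≤⟨ *-mono-≤ (0≤ι (suc m)) (ι-mono (ℕ.s≤s m≤n)) (0≤* (0≤h m) (0≤h n)) ≤-refl ⟩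
  ι (suc n) * (h m * h n)      ≡⟨ solve 3 (λ x y z → x :* (y :* z) := x :* z :* y) refl (ι (suc n)) (h m) (h n) ⟩
  ι (suc n) * h n * h m        ≡⟨ cong (_* h m) (ι*h n) ⟩
  1ℚ * h m                     ≡⟨ *-identityˡ (h m) ⟩
  h m                          ∎
  where open ≤-Reasoning

h-zero : h 0 ≡ 1ℚ
h-zero = trans (sym (*-identityˡ (h 0))) (trans (cong (_* h 0) (sym ι-one)) (ι*h 0))

h≤1 : ∀ n → h n ≤ 1ℚ
h≤1 n = ≤-trans (h-anti ℕ.z≤n) (≤-reflexive h-zero)

ι*h≤1 : ∀ n → ι n * h n ≤ 1ℚ
ι*h≤1 n = ≤-trans (*-monoʳ-≤-nonNeg (h n) {{nonNegative (0≤h n)}} (ι-mono (ℕ.n≤1+n n))) (≤-reflexive (ι*h n))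

0≤o : ∀ i → 0ℚ ≤ o i
0≤o i = 0≤h (2 ℕ.* i)

o≤h : ∀ i → o i ≤ h i
o≤h i = h-anti (ℕ.m≤m+n i (i ℕ.+ 0))

o≤1 : ∀ i → o i ≤ 1ℚ
o≤1 i = h≤1 (2 ℕ.* i)

∑-const : ∀ n c → ∑ n (λ _ → c) ≡ ι n * c
∑-const zero    c = trans (sym (*-zeroˡ c)) (cong (_* c) (sym ι-zero))
∑-const (suc n) c = trans (cong (_+ c) (∑-const n c))
  (trans (solve 2 (λ x c → x :* c :+ c := (con 1ℚ :+ x) :* c) refl (ι n) c) (cong (_* c) (sym (ι-suc n))))

-- Leibniz's criterion in a form that survives induction: splitting off the first term replaces `T`
-- by `h m - T`, which stays between 0 and `h m` because `h` decreases.
alternating-tail : ∀ d m → ∃[ T ] (∑ d (λ j → a (m ℕ.+ j)) ≡ s (suc m) * T × 0ℚ ≤ T × T ≤ h m)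
alternating-tail zero    m = 0ℚ , sym (*-zeroʳ (s (suc m))) , ≤-refl , 0≤h m
alternating-tail (suc d) m with alternating-tail d (suc m)
... | T , e , 0≤T , T≤h = h m - T
  , trans (∑-first d (λ j → a (m ℕ.+ j))) (trans (cong₂ _+_ (cong a (ℕ.+-identityʳ m))
      (trans (∑-cong d (λ j _ → cong a (ℕ.+-suc m j))) e))
      (solve 3 (λ σ x T → σ :* x :+ con (- 1ℚ) :* σ :* T := σ :* (x :- T)) refl (s (suc m)) (h m) T))
  , ≤-from-difference (≤-trans (≤-reflexive (sym (+-inverseʳ T))) (+-monoˡ-≤ (- T) (≤-trans T≤h (h-anti (ℕ.n≤1+n m)))))
      (sym (+-identityˡ (h m - T)))
  , ≤-from-difference 0≤T (solve 2 (λ x T → x := (x :- T) :+ T) refl (h m) T)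

∣alternating-tail∣≤ : ∀ d m → ∣ ∑ d (λ j → a (m ℕ.+ j)) ∣ ≤ h m
∣alternating-tail∣≤ d m with alternating-tail d m
... | T , e , 0≤T , T≤h = begin
  ∣ ∑ d (λ j → a (m ℕ.+ j)) ∣   ≡⟨ cong ∣_∣ e ⟩
  ∣ s (suc m) * T ∣             ≡⟨ ∣p*q∣≡∣p∣*∣q∣ (s (suc m)) T ⟩
  ∣ s (suc m) ∣ * ∣ T ∣         ≡⟨ cong₂ _*_ (∣sign∣ (suc m)) (0≤p⇒∣p∣≡p 0≤T) ⟩
  1ℚ * T                        ≡⟨ *-identityˡ T ⟩
  T                             ≤⟨ T≤h ⟩
  h m                           ∎
  where open ≤-Reasoning

∣h-tail∣≤ : ∀ d m → ∣ ∑ d (λ j → h (m ℕ.+ j)) ∣ ≤ ι d * h m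
∣h-tail∣≤ d m = begin
  ∣ ∑ d (λ j → h (m ℕ.+ j)) ∣   ≤⟨ ∣∑∣≤ d (λ j _ → ≤-reflexive (0≤p⇒∣p∣≡p (0≤h (m ℕ.+ j)))) ⟩
  ∑ d (λ j → h (m ℕ.+ j))       ≤⟨ ∑-mono d (λ j _ → h-anti (ℕ.m≤m+n m j)) ⟩
  ∑ d (λ _ → h m)               ≡⟨ ∑-const d (h m) ⟩
  ι d * h m                     ∎
  where open ≤-Reasoning

-- The subscript i of o belongs to 2i + 1, and N ∸ suc i to N - i, so this is Σ_{i<N} 1 / ((2i + 1)(N - i)).
E : ℕ → ℚ
E N = ∑ N (λ i → h (N ℕ.∸ suc i) * o i)

-- The bracket in the i-th summand is minus a block of 2i + 1 consecutive values of `c`, starting at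
-- N - 1 - i. A bound on each block therefore suffices.
∣window∣≤ : ∀ c w → (∀ m i → ∣ ∑ (suc (2 ℕ.* i)) (λ j → c (m ℕ.+ j)) * w i ∣ ≤ h m * o i) →
  ∀ N → ∣ window c w N ∣ ≤ E N
∣window∣≤ c w bound N = ∣∑∣≤ N λ i i<N → ≤-trans (≤-reflexive (difference i i<N)) (bound (N ℕ.∸ suc i) i)
  where
  open ≡-Reasoning
  difference : ∀ i → i ℕ.< N → ∣ (∑ (N ℕ.∸ suc i) c - ∑ (N ℕ.+ i) c) * w i ∣
    ≡ ∣ ∑ (suc (2 ℕ.* i)) (λ j → c ((N ℕ.∸ suc i) ℕ.+ j)) * w i ∣
  difference i i<N = begin
    ∣ (∑ m c - ∑ (N ℕ.+ i) c) * w i ∣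
      ≡⟨ cong (λ k → ∣ (∑ m c - ∑ k c) * w i ∣) N+i≡ ⟩
    ∣ (∑ m c - ∑ (m ℕ.+ suc (2 ℕ.* i)) c) * w i ∣
      ≡⟨ cong (λ x → ∣ (∑ m c - x) * w i ∣) (∑-split m (suc (2 ℕ.* i)) c) ⟩
    ∣ (∑ m c - (∑ m c + T)) * w i ∣
      ≡⟨ cong ∣_∣ (solve 3 (λ x T w → (x :- (x :+ T)) :* w := :- (T :* w)) refl (∑ m c) T (w i)) ⟩
    ∣ - (T * w i) ∣
      ≡⟨ ∣-p∣≡∣p∣ (T * w i) ⟩
    ∣ T * w i ∣   ∎
    where
    m = N ℕ.∸ suc i
    T = ∑ (suc (2 ℕ.* i)) (λ j → c (m ℕ.+ j))
    N+i≡ : N ℕ.+ i ≡ m ℕ.+ suc (2 ℕ.* i)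
    N+i≡ = begin
      N ℕ.+ i                    ≡⟨ cong (ℕ._+ i) (ℕ.m∸n+n≡m i<N) ⟨
      m ℕ.+ suc i ℕ.+ i          ≡⟨ ℕ.+-assoc m (suc i) i ⟩
      m ℕ.+ suc (i ℕ.+ i)        ≡⟨ cong (λ k → m ℕ.+ suc (i ℕ.+ k)) (ℕ.+-identityʳ i) ⟨
      m ℕ.+ suc (2 ℕ.* i)        ∎

∣p*q∣≤ : ∀ {p q b} → 0ℚ ≤ q → ∣ p ∣ ≤ b → ∣ p * q ∣ ≤ b * q
∣p*q∣≤ {p} {q} {b} 0≤q p≤b = ≤-trans
  (≤-reflexive (trans (∣p*q∣≡∣p∣*∣q∣ p q) (cong (∣ p ∣ *_) (0≤p⇒∣p∣≡p 0≤q))))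
  (*-monoʳ-≤-nonNeg q {{nonNegative 0≤q}} p≤b)

∣window-a∣≤ : ∀ N → ∣ window a o N ∣ ≤ E N
∣window-a∣≤ = ∣window∣≤ a o λ m i → ∣p*q∣≤ (0≤o i) (∣alternating-tail∣≤ (suc (2 ℕ.* i)) m)

-- A block of 2i + 1 values of `h` costs one of the three factors `o i`; a second is bounded by 1.
∣window-h∣≤ : ∀ N → ∣ window h o³ N ∣ ≤ E N
∣window-h∣≤ = ∣window∣≤ h o³ bound
  where
  bound : ∀ m i → ∣ ∑ (suc (2 ℕ.* i)) (λ j → h (m ℕ.+ j)) * o³ i ∣ ≤ h m * o i
  bound m i = begin
    ∣ ∑ (suc (2 ℕ.* i)) (λ j → h (m ℕ.+ j)) * o³ i ∣
      ≤⟨ ∣p*q∣≤ (0≤* (0≤o i) (0≤* (0≤o i) (0≤o i))) (∣h-tail∣≤ (suc (2 ℕ.* i)) m) ⟩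
    ι (suc (2 ℕ.* i)) * h m * o³ i
      ≡⟨ solve 3 (λ d x o → d :* x :* (o :* (o :* o)) := d :* o :* (x :* o :* o)) refl (ι (suc (2 ℕ.* i))) (h m) (o i) ⟩
    ι (suc (2 ℕ.* i)) * o i * (h m * o i * o i)
      ≡⟨ trans (cong (_* (h m * o i * o i)) (ι*h (2 ℕ.* i))) (*-identityˡ _) ⟩
    h m * o i * o i
      ≤⟨ *-mono-≤ (0≤* (0≤h m) (0≤o i)) ≤-refl (0≤o i) (o≤1 i) ⟩
    h m * o i * 1ℚ
      ≡⟨ *-identityʳ (h m * o i) ⟩
    h m * o i   ∎
    where open ≤-Reasoning

H : ℕ → ℚ
H n = ∑ n h

-- By `h*o-near` each product splits into `o N` times a sum of two reciprocals, and each of these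
-- sums separately to a multiple of a harmonic-type sum.
E≤ : ∀ N → E N ≤ 3ℚ * (o N * H N)
E≤ N = begin
  E N
    ≡⟨ ∑-cong N (λ i i<N → subst (λ M → h (N ℕ.∸ suc i) * o i ≡ o M * (2ℚ * o i + 1ℚ * h (N ℕ.∸ suc i)))
         (ℕ.m∸n+n≡m i<N) (h*o-near (N ℕ.∸ suc i) i)) ⟩
  ∑ N (λ i → o N * (2ℚ * o i + 1ℚ * h (N ℕ.∸ suc i)))
    ≡⟨ trans (∑-* N (o N) _) (cong (o N *_) (trans (∑-+ N _ _)
         (cong₂ _+_ (∑-* N 2ℚ o) (trans (∑-* N 1ℚ _) (cong (1ℚ *_) (∑-reverse N h)))))) ⟩
  o N * (2ℚ * ∑ N o + 1ℚ * H N)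
    ≤⟨ *-monoˡ-≤-nonNeg (o N) {{nonNegative (0≤o N)}}
         (+-monoˡ-≤ (1ℚ * H N) (*-monoˡ-≤-nonNeg 2ℚ (∑-mono N (λ i _ → o≤h i)))) ⟩
  o N * (2ℚ * H N + 1ℚ * H N)
    ≡⟨ solve 2 (λ u x → u :* (con 2ℚ :* x :+ con 1ℚ :* x) := con 3ℚ :* (u :* x)) refl (o N) (H N) ⟩
  3ℚ * (o N * H N)   ∎
  where open ≤-Reasoning

0≤H : ∀ N → 0ℚ ≤ H N
0≤H N = ∑-nonNeg N 0≤h

H≤ι : ∀ N → H N ≤ ι N
H≤ι N = ≤-trans (∑-mono N (λ i _ → h≤1 i)) (≤-reflexive (trans (∑-const N 1ℚ) (*-identityʳ (ι N))))

-- A substitute for the logarithmic growth of H that needs only H ≤ ι.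
H²≤3ι : ∀ N → H N * H N ≤ 3ℚ * ι N
H²≤3ι zero    = ≤-reflexive (trans (*-zeroˡ 0ℚ) (trans (sym (*-zeroʳ 3ℚ)) (cong (3ℚ *_) (sym ι-zero))))
H²≤3ι (suc N) = begin
  (H N + h N) * (H N + h N)
    ≡⟨ solve 2 (λ x y → (x :+ y) :* (x :+ y) := x :* x :+ con 2ℚ :* (x :* y) :+ y :* y) refl (H N) (h N) ⟩
  H N * H N + 2ℚ * (H N * h N) + h N * h N
    ≤⟨ +-mono-≤ (+-mono-≤ (H²≤3ι N) (*-monoˡ-≤-nonNeg 2ℚ (≤-trans
         (*-monoʳ-≤-nonNeg (h N) {{nonNegative (0≤h N)}} (H≤ι N)) (ι*h≤1 N))))
         (*-mono-≤ (0≤h N) (h≤1 N) (0≤h N) (h≤1 N)) ⟩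
  3ℚ * ι N + 2ℚ * 1ℚ + 1ℚ * 1ℚ
    ≡⟨ solve 1 (λ x → con 3ℚ :* x :+ con 2ℚ :* con 1ℚ :+ con 1ℚ :* con 1ℚ := con 3ℚ :* (con 1ℚ :+ x)) refl (ι N) ⟩
  3ℚ * (1ℚ + ι N)
    ≡⟨ cong (3ℚ *_) (ι-suc N) ⟨
  3ℚ * ι (suc N)   ∎
  where open ≤-Reasoning

[o*H]²≤h : ∀ N → o N * H N * (o N * H N) ≤ h N
[o*H]²≤h N = begin
  o N * H N * (o N * H N)
    ≡⟨ solve 2 (λ u x → u :* x :* (u :* x) := u :* u :* (x :* x)) refl (o N) (H N) ⟩
  o N * o N * (H N * H N)
    ≤⟨ *-monoˡ-≤-nonNeg (o N * o N) {{nonNegative 0≤o²}} (H²≤3ι N) ⟩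
  o N * o N * (3ℚ * ι N)
    ≡⟨ *-identityʳ _ ⟨
  o N * o N * (3ℚ * ι N) * 1ℚ
    ≡⟨ cong (o N * o N * (3ℚ * ι N) *_) (ι*h′ N) ⟨
  o N * o N * (3ℚ * ι N) * ((1ℚ + ι N) * h N)
    -- Here (2N + 1)² = 3N(N + 1) + (N² + N + 1).
    ≤⟨ ≤-from-difference (0≤* (0≤* 0≤o² (0≤+ (0≤+ (0≤* (0≤ι N) (0≤ι N)) (0≤ι N)) 0≤1)) (0≤h N))
         (solve 3 (λ x u y → (con 1ℚ :+ con 2ℚ :* x) :* u :* ((con 1ℚ :+ con 2ℚ :* x) :* u) :* y
            := u :* u :* (con 3ℚ :* x) :* ((con 1ℚ :+ x) :* y) :+ u :* u :* (x :* x :+ x :+ con 1ℚ) :* y) refl (ι N) (o N) (h N)) ⟩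
  (1ℚ + 2ℚ * ι N) * o N * ((1ℚ + 2ℚ * ι N) * o N) * h N
    ≡⟨ cong (λ p → p * p * h N) (ι*o N) ⟩
  1ℚ * 1ℚ * h N
    ≡⟨ *-identityˡ (h N) ⟩
  h N   ∎
  where
  open ≤-Reasoning
  0≤o² = 0≤* (0≤o N) (0≤o N)

-- The WZ pair

-- With u = 2n + 1, κ n k · (1 + Λ n k · x²) is the expansion up to order x² of
--   4ᵏ k!² (1 - x)ₖ (1 + x)ₖ / ((2k)! ∏_{j≤k} ((u + 2j)² - x²)),
-- which at k = 0 is 1 / (u² - x²).  The companion of this kernel in the WZ pair is
-- (2n + 3k + 2) / (2(2k + 1)) times the kernel, and τ is its coefficient of x².
κ Λ τ : ℕ → ℕ → ℚ
κ n zero    = o n * o n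
κ n (suc k) = κ n k * (2ℚ * y * y * y * o k * (W * W))
  where
  y = 1ℚ + ι k
  W = o (n ℕ.+ suc k)
Λ n k = ∑ (suc k) (λ j → o (n ℕ.+ j) * o (n ℕ.+ j)) - ∑ k (λ j → h j * h j)
τ n k = ½ * (2ℚ * ι n + 3ℚ * ι k + 2ℚ) * o k * (κ n k * Λ n k)

-- Passing from n to n + 1 moves the product over the denominators by one place: at order zero, the
-- factor 1/(2n + 1)² is lost and the square of `o (n ℕ.+ suc k)` is gained. `Λ-shift` is the
-- additive counterpart.
κ-shift : ∀ n k → κ (suc n) k ≡
  κ n k * ((1ℚ + 2ℚ * ι n) * (1ℚ + 2ℚ * ι n) * (o (n ℕ.+ suc k) * o (n ℕ.+ suc k)))
κ-shift n zero = begin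
  o (suc n) * o (suc n)
    ≡⟨ cong (λ k → o k * o k) (ℕ.+-comm 1 n) ⟩
  W * W
    ≡⟨ solve 1 (λ W → W :* W := con 1ℚ :* con 1ℚ :* (W :* W)) refl W ⟩
  1ℚ * 1ℚ * (W * W)
    ≡⟨ cong (λ p → p * p * (W * W)) (ι*o n) ⟨
  u * o n * (u * o n) * (W * W)
    ≡⟨ solve 3 (λ u v W → u :* v :* (u :* v) :* (W :* W) := v :* v :* (u :* u :* (W :* W))) refl u (o n) W ⟩
  o n * o n * (u * u * (W * W))   ∎
  where
  open ≡-Reasoning
  u = 1ℚ + 2ℚ * ι n
  W = o (n ℕ.+ 1)
κ-shift n (suc k) = begin
  κ (suc n) k * (2ℚ * y * y * y * o k * (o (suc n ℕ.+ suc k) * o (suc n ℕ.+ suc k)))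
    ≡⟨ cong₂ (λ p i → p * (2ℚ * y * y * y * o k * (o i * o i))) (κ-shift n k) (sym (ℕ.+-suc n (suc k))) ⟩
  κ n k * (u * u * (W * W)) * (2ℚ * y * y * y * o k * (V * V))
    ≡⟨ solve 6 (λ F u W y c V → F :* (u :* u :* (W :* W)) :* (con 2ℚ :* y :* y :* y :* c :* (V :* V))
         := F :* (con 2ℚ :* y :* y :* y :* c :* (W :* W)) :* (u :* u :* (V :* V))) refl (κ n k) u W y (o k) V ⟩
  κ n (suc k) * (u * u * (V * V))   ∎
  where
  open ≡-Reasoning
  u = 1ℚ + 2ℚ * ι n
  y = 1ℚ + ι k
  W = o (n ℕ.+ suc k)
  V = o (n ℕ.+ suc (suc k))

Λ-shift : ∀ n k → Λ (suc n) k ≡ Λ n k - o n * o n + o (n ℕ.+ suc k) * o (n ℕ.+ suc k)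
Λ-shift n k = begin
  ∑ (suc k) (λ j → o (suc n ℕ.+ j) * o (suc n ℕ.+ j)) - B
    ≡⟨ cong (_- B) (∑-cong (suc k) (λ j _ → cong (λ i → o i * o i) (sym (ℕ.+-suc n j)))) ⟩
  ∑ (suc k) (g ∘ suc) - B
    ≡⟨ solve 3 (λ g₀ S B → S :- B := (g₀ :+ S) :- g₀ :- B) refl (g 0) (∑ (suc k) (g ∘ suc)) B ⟩
  (g 0 + ∑ (suc k) (g ∘ suc)) - g 0 - B
    ≡⟨ cong₂ (λ p i → p - o i * o i - B) (sym (∑-first (suc k) g)) (ℕ.+-identityʳ n) ⟩
  (∑ (suc k) g + g (suc k)) - o n * o n - B
    ≡⟨ solve 4 (λ S g v B → (S :+ g) :- v :- B := (S :- B) :- v :+ g) refl (∑ (suc k) g) (g (suc k)) (o n * o n) B ⟩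
  Λ n k - o n * o n + g (suc k)   ∎
  where
  open ≡-Reasoning
  g : ℕ → ℚ
  g j = o (n ℕ.+ j) * o (n ℕ.+ j)
  B = ∑ k (λ j → h j * h j)

-- `x` and `y` stand for n and k; `c`, `W`, `v`, `g` for the reciprocals of 2k + 1, 2(n + k + 1) +
-- 1, 2n + 1, k + 1; and `F`, `G` for `κ n k`, `Λ n k`. With these opaque, the WZ equation is a
-- polynomial identity modulo the four reciprocal relations.
module _ (x y c W v g F G : ℚ) where
  private
    u w q q′ : ℚ
    u  = 1ℚ + 2ℚ * x
    w  = 1ℚ + 2ℚ * (x + (1ℚ + y))
    q  = ½ * (2ℚ * x + 3ℚ * y + 2ℚ) * c
    q′ = ½ * (2ℚ * (1ℚ + x) + 3ℚ * y + 2ℚ) * c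

    -- The two sides of the identity differ by a combination of the hypotheses
    -- p = 1, r = 1, m = 1, z = 1 on the products of reciprocal pairs.
    defect : ℚ → ℚ → ℚ → ℚ → ℚ
    defect p r m z = F * G * ((q - r) * (1ℚ - p * p) - (1ℚ - r))
      + F * (W * W) * (q′ * (m * m - p * p) - 2ℚ * (1ℚ + y) * c * (z * z - p * p))

  wz-identity : w * W ≡ 1ℚ → (1ℚ + 2ℚ * y) * c ≡ 1ℚ → u * v ≡ 1ℚ → (1ℚ + y) * g ≡ 1ℚ →
    q * (F * G) - q′ * (F * (u * u * (W * W)) * (G - v * v + W * W))
    ≡ F * G - F * (2ℚ * (1ℚ + y) * (1ℚ + y) * (1ℚ + y) * c * (W * W)) * (G + W * W - g * g)
  wz-identity wW yc uv yg = begin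
    q * (F * G) - q′ * (F * (u * u * (W * W)) * (G - v * v + W * W))
      ≡⟨ solve 8 (λ x y c W v g F G →
           let u  = con 1ℚ :+ con 2ℚ :* x
               w  = con 1ℚ :+ con 2ℚ :* (x :+ (con 1ℚ :+ y))
               q  = con ½ :* (con 2ℚ :* x :+ con 3ℚ :* y :+ con 2ℚ) :* c
               q′ = con ½ :* (con 2ℚ :* (con 1ℚ :+ x) :+ con 3ℚ :* y :+ con 2ℚ) :* c
               p  = w :* W
               r  = (con 1ℚ :+ con 2ℚ :* y) :* c
               m  = u :* v
               z  = (con 1ℚ :+ y) :* g
           in q :* (F :* G) :- q′ :* (F :* (u :* u :* (W :* W)) :* (G :- v :* v :+ W :* W))
              := F :* G :- F :* (con 2ℚ :* (con 1ℚ :+ y) :* (con 1ℚ :+ y) :* (con 1ℚ :+ y) :* c :* (W :* W)) :* (G :+ W :* W :- g :* g)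
                 :+ (F :* G :* ((q :- r) :* (con 1ℚ :- p :* p) :- (con 1ℚ :- r))
                   :+ F :* (W :* W) :* (q′ :* (m :* m :- p :* p) :- con 2ℚ :* (con 1ℚ :+ y) :* c :* (z :* z :- p :* p))))
           refl x y c W v g F G ⟩
    rhs + defect (w * W) ((1ℚ + 2ℚ * y) * c) (u * v) ((1ℚ + y) * g)
      ≡⟨ cong (_+_ rhs) (trans (cong₂ (λ p r → defect p r (u * v) ((1ℚ + y) * g)) wW yc) (cong₂ (defect 1ℚ 1ℚ) uv yg)) ⟩
    rhs + defect 1ℚ 1ℚ 1ℚ 1ℚ
      ≡⟨ cong (_+_ rhs) (solve 6 (λ A B q q′ y c →
           A :* ((q :- con 1ℚ) :* (con 1ℚ :- con 1ℚ :* con 1ℚ) :- (con 1ℚ :- con 1ℚ))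
           :+ B :* (q′ :* (con 1ℚ :* con 1ℚ :- con 1ℚ :* con 1ℚ) :- con 2ℚ :* (con 1ℚ :+ y) :* c :* (con 1ℚ :* con 1ℚ :- con 1ℚ :* con 1ℚ))
           := con 0ℚ) refl (F * G) (F * (W * W)) q q′ y c) ⟩
    rhs + 0ℚ
      ≡⟨ +-identityʳ rhs ⟩
    rhs   ∎
    where
    open ≡-Reasoning
    rhs = F * G - F * (2ℚ * (1ℚ + y) * (1ℚ + y) * (1ℚ + y) * c * (W * W)) * (G + W * W - g * g)

wz : ∀ n k → τ n k - τ (suc n) k ≡ κ n k * Λ n k - κ n (suc k) * Λ n (suc k)
wz n k = begin
  τ n k - τ (suc n) k
    ≡⟨ cong (λ p → τ n k - p) (trans
         (cong (λ x → ½ * (2ℚ * x + 3ℚ * ι k + 2ℚ) * o k * (κ (suc n) k * Λ (suc n) k)) (ι-suc n))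
         (cong₂ (λ p q → ½ * (2ℚ * (1ℚ + ι n) + 3ℚ * ι k + 2ℚ) * o k * (p * q)) (κ-shift n k) (Λ-shift n k))) ⟩
  τ n k - ½ * (2ℚ * (1ℚ + ι n) + 3ℚ * ι k + 2ℚ) * o k
    * (κ n k * ((1ℚ + 2ℚ * ι n) * (1ℚ + 2ℚ * ι n) * (W * W)) * (Λ n k - o n * o n + W * W))
    ≡⟨ wz-identity (ι n) (ι k) (o k) W (o n) (h k) (κ n k) (Λ n k)
         (trans (cong (λ x → (1ℚ + 2ℚ * x) * W) (sym (ι-sum n k))) (ι*o (n ℕ.+ suc k)))
         (ι*o k) (ι*o n) (ι*h′ k) ⟩
  κ n k * Λ n k - κ n (suc k) * (Λ n k + W * W - h k * h k)
    ≡⟨ cong (λ p → κ n k * Λ n k - κ n (suc k) * p)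
         (solve 4 (λ S B w z → (S :- B) :+ w :- z := (S :+ w) :- (B :+ z)) refl
           (∑ (suc k) (λ j → o (n ℕ.+ j) * o (n ℕ.+ j))) (∑ k (λ j → h j * h j)) (W * W) (h k * h k)) ⟩
  κ n k * Λ n k - κ n (suc k) * Λ n (suc k)   ∎
  where
  open ≡-Reasoning
  W = o (n ℕ.+ suc k)

κΛ-zero : ∀ n → κ n 0 * Λ n 0 ≡ o n * o n * (o n * o n)
κΛ-zero n = cong (o n * o n *_) (trans
  (solve 1 (λ x → (con 0ℚ :+ x) :- con 0ℚ := x) refl (o (n ℕ.+ 0) * o (n ℕ.+ 0)))
  (cong (λ i → o i * o i) (ℕ.+-identityʳ n)))

wz-column : ∀ n M → ∑ M (τ n) - ∑ M (τ (suc n)) ≡ κ n 0 * Λ n 0 - κ n M * Λ n M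
wz-column n zero    = sym (+-inverseʳ (κ n 0 * Λ n 0))
wz-column n (suc M) = trans
  (solve 4 (λ a b c d → (a :+ c) :- (b :+ d) := (a :- b) :+ (c :- d)) refl
    (∑ M (τ n)) (∑ M (τ (suc n))) (τ n M) (τ (suc n) M))
  (trans (cong₂ _+_ (wz-column n M) (wz n M))
    (solve 3 (λ a b c → (a :- b) :+ (b :- c) := a :- c) refl
      (κ n 0 * Λ n 0) (κ n M * Λ n M) (κ n (suc M) * Λ n (suc M))))

-- Both sides of `wz` are differences, so summing over a rectangle leaves its four edges: n = 0
-- carries the series, k = 0 carries `t₄`, and the two far edges form the error.
wz-rectangle : ∀ N M → ∑ M (τ 0) ≡ t₄ N + (∑ M (τ N) - ∑ N (λ n → κ n M * Λ n M))
wz-rectangle zero    M = solve 1 (λ a → a := con 0ℚ :+ (a :- con 0ℚ)) refl (∑ M (τ 0))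
wz-rectangle (suc N) M = begin
  ∑ M (τ 0)
    ≡⟨ wz-rectangle N M ⟩
  t₄ N + (∑ M (τ N) - B)
    ≡⟨ solve 4 (λ a b c d → a :+ (b :- d) := a :+ ((b :- c) :+ c :- d)) refl
         (t₄ N) (∑ M (τ N)) (∑ M (τ (suc N))) B ⟩
  t₄ N + ((∑ M (τ N) - ∑ M (τ (suc N))) + ∑ M (τ (suc N)) - B)
    ≡⟨ cong (λ p → t₄ N + (p + ∑ M (τ (suc N)) - B))
         (trans (wz-column N M) (cong (_- κ N M * Λ N M) (κΛ-zero N))) ⟩
  t₄ N + ((v - κ N M * Λ N M) + ∑ M (τ (suc N)) - B)
    ≡⟨ solve 5 (λ a v e c B → a :+ ((v :- e) :+ c :- B) := (a :+ v) :+ (c :- (B :+ e))) refl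
         (t₄ N) v (κ N M * Λ N M) (∑ M (τ (suc N))) B ⟩
  t₄ (suc N) + (∑ M (τ (suc N)) - ∑ (suc N) (λ n → κ n M * Λ n M))   ∎
  where
  open ≡-Reasoning
  v = o N * o N * (o N * o N)
  B = ∑ N (λ n → κ n M * Λ n M)

-- The terms of the series as values of the WZ companion

h-half : ∀ n → h (suc (2 ℕ.* n)) ≡ ½ * h n
h-half n = begin
  z                                       ≡⟨ *-identityʳ z ⟨
  z * 1ℚ                                  ≡⟨ cong (z *_) (ι*h′ n) ⟨
  z * ((1ℚ + ι n) * h n)                  ≡⟨ solve 3 (λ z x y → z :* ((con 1ℚ :+ x) :* y)
                                               := (con 1ℚ :+ (con 1ℚ :+ con 2ℚ :* x)) :* z :* (con ½ :* y)) refl z (ι n) (h n) ⟩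
  (1ℚ + (1ℚ + 2ℚ * ι n)) * z * (½ * h n)  ≡⟨ cong (λ x → (1ℚ + x) * z * (½ * h n)) (ι-odd n) ⟨
  (1ℚ + ι (suc (2 ℕ.* n))) * z * (½ * h n) ≡⟨ cong (_* (½ * h n)) (ι*h′ (suc (2 ℕ.* n))) ⟩
  1ℚ * (½ * h n)                          ≡⟨ *-identityˡ (½ * h n) ⟩
  ½ * h n                                 ∎
  where
  open ≡-Reasoning
  z = h (suc (2 ℕ.* n))

H⁽²⁾≡∑h² : ∀ n → H⁽²⁾ n ≡ ∑ n (λ i → h i * h i)
H⁽²⁾≡∑h² n = ∑-cong n (λ i _ → trans (h-def (i ℕ.+ i ℕ.* suc i)) (sym (h-* i i)))

-- Among the denominators 1, ..., 2k + 1 there are k + 1 odd ones, while the even ones 2, ..., 2k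
-- contribute a quarter of the sum up to k.
∑h²-odd : ∀ k → ∑ (suc (2 ℕ.* k)) (λ i → h i * h i) ≡
  ∑ (suc k) (λ i → o i * o i) + ¼ * ∑ k (λ i → h i * h i)
∑h²-odd zero    = solve 1 (λ x → con 0ℚ :+ x := con 0ℚ :+ x :+ con ¼ :* con 0ℚ) refl (h 0 * h 0)
∑h²-odd (suc k) = begin
  S + h (2 ℕ.* suc k) * h (2 ℕ.* suc k)
    ≡⟨ cong (_+ o (suc k) * o (suc k)) (trans (cong (λ m → ∑ m h²) (ℕ.*-suc 2 k))
         (cong₂ _+_ (∑h²-odd k) (cong (λ p → p * p) (h-half k)))) ⟩
  (∑ (suc k) o² + ¼ * ∑ k h²) + ½ * h k * (½ * h k) + o² (suc k)
    ≡⟨ solve 4 (λ a b x w → (a :+ con ¼ :* b) :+ con ½ :* x :* (con ½ :* x) :+ w := (a :+ w) :+ con ¼ :* (b :+ x :* x)) refl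
         (∑ (suc k) o²) (∑ k h²) (h k) (o² (suc k)) ⟩
  ∑ (suc (suc k)) o² + ¼ * ∑ (suc k) h²   ∎
  where
  open ≡-Reasoning
  h² o² : ℕ → ℚ
  h² i = h i * h i
  o² i = o i * o i
  S = ∑ (2 ℕ.* suc k) h²

-- The quarter coming from the even denominators reduces 5/4 to 1, and the coefficient `Λ 0 k`
-- remains.
harmonic-factor : ∀ k → H⁽²⁾ (2 ℕ.* k ℕ.+ 1) - + 5 / 4 * H⁽²⁾ k ≡ Λ 0 k
harmonic-factor k = trans
  (cong₂ (λ p q → p - + 5 / 4 * q)
    (trans (cong H⁽²⁾ (ℕ.+-comm (2 ℕ.* k) 1)) (trans (H⁽²⁾≡∑h² (suc (2 ℕ.* k))) (∑h²-odd k)))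
    (H⁽²⁾≡∑h² k))
  (solve 2 (λ a b → a :+ con ¼ :* b :- con (+ 5 / 4) :* b := a :- b) refl
    (∑ (suc k) (λ i → o i * o i)) (∑ k (λ i → h i * h i)))

-- Division-free form of the quotient in `seriesTerm`. In the induction step the cube of 3/2 + k =
-- (2k + 3)/2 meets the cube of `o (suc k)`, and the factors 2 from `κ` and 4 from the power cancel
-- the remaining 2³.
o*κ*denominator : ∀ k → o k * κ 0 k * denominator k ≡ shiftedFactorial 1ℚ k ^ 3
o*κ*denominator zero    = cong (λ p → p * (p * p) * 1ℚ) h-zero
o*κ*denominator (suc k) = begin
  W * (F * (2ℚ * y * y * y * c * (W * W))) * ((P * (+ 3 / 2 + + k / 1)) ^ 3 * (+ 4 / 1 * D))
    ≡⟨ cong (λ x → W * (F * (2ℚ * y * y * y * c * (W * W))) * ((P * (+ 3 / 2 + x)) ^ 3 * (+ 4 / 1 * D))) (ι-def k) ⟩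
  W * (F * (2ℚ * y * y * y * c * (W * W))) * ((P * (+ 3 / 2 + x)) ^ 3 * (+ 4 / 1 * D))
    ≡⟨ solve 6 (λ W F x c P D →
         let y = con 1ℚ :+ x
             A = P :* (con (+ 3 / 2) :+ x)
             w = (con 1ℚ :+ con 2ℚ :* (con 1ℚ :+ x)) :* W
         in W :* (F :* (con 2ℚ :* y :* y :* y :* c :* (W :* W))) :* (A :* (A :* (A :* con 1ℚ)) :* (con (+ 4 / 1) :* D))
            := c :* F :* (P :* (P :* (P :* con 1ℚ)) :* D) :* (y :* y :* y) :* (w :* w :* w)) refl W F x c P D ⟩
  c * F * (P ^ 3 * D) * (y * y * y) * ((1ℚ + 2ℚ * (1ℚ + x)) * W * ((1ℚ + 2ℚ * (1ℚ + x)) * W) * ((1ℚ + 2ℚ * (1ℚ + x)) * W))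
    ≡⟨ cong₂ (λ p q → p * (y * y * y) * (q * q * q)) (o*κ*denominator k)
         (trans (cong (λ z → (1ℚ + 2ℚ * z) * W) (sym (ι-suc k))) (ι*o (suc k))) ⟩
  S ^ 3 * (y * y * y) * (1ℚ * 1ℚ * 1ℚ)
    ≡⟨ solve 2 (λ S y → S :* (S :* (S :* con 1ℚ)) :* (y :* y :* y) :* (con 1ℚ :* con 1ℚ :* con 1ℚ)
         := (S :* y) :* ((S :* y) :* ((S :* y) :* con 1ℚ))) refl S y ⟩
  (S * y) ^ 3
    ≡⟨ cong (λ x → (S * (1ℚ + x)) ^ 3) (ι-def k) ⟨
  (S * (1ℚ + + k / 1)) ^ 3   ∎
  where
  open ≡-Reasoning
  W = o (suc k)
  F = κ 0 k
  x = ι k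
  y = 1ℚ + ι k
  c = o k
  P = shiftedFactorial (+ 3 / 2) k
  S = shiftedFactorial 1ℚ k
  D = (+ 4 / 1) ^ k

÷-unique : ∀ {p q r} .{{_ : NonZero q}} → r * q ≡ p → p ÷ q ≡ r
÷-unique {p} {q} {r} e = begin
  p * 1/ q         ≡⟨ cong (_* 1/ q) e ⟨
  r * q * 1/ q     ≡⟨ *-assoc r q (1/ q) ⟩
  r * (q * 1/ q)   ≡⟨ cong (r *_) (*-inverseʳ q) ⟩
  r * 1ℚ           ≡⟨ *-identityʳ r ⟩
  r                ∎
  where open ≡-Reasoning

ι-3k+2 : ∀ k → ι (3 ℕ.* k ℕ.+ 2) ≡ 2ℚ * ι 0 + 3ℚ * ι k + 2ℚ
ι-3k+2 k = begin
  ι (3 ℕ.* k ℕ.+ 2)               ≡⟨ trans (ι-+ (3 ℕ.* k) 2) (cong (_+ ι 2) (ι-* 3 k)) ⟩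
  ι 3 * ι k + ι 2                 ≡⟨ cong₂ (λ p q → p * ι k + q) (trans (ι-suc 2) (cong (_+_ 1ℚ) ι-two)) ι-two ⟩
  3ℚ * ι k + 2ℚ                   ≡⟨ solve 1 (λ x → con 3ℚ :* x :+ con 2ℚ := con 2ℚ :* con 0ℚ :+ con 3ℚ :* x :+ con 2ℚ) refl (ι k) ⟩
  2ℚ * 0ℚ + 3ℚ * ι k + 2ℚ         ≡⟨ cong (λ p → 2ℚ * p + 3ℚ * ι k + 2ℚ) ι-zero ⟨
  2ℚ * ι 0 + 3ℚ * ι k + 2ℚ        ∎
  where open ≡-Reasoning

seriesTerm≡2τ : ∀ k → seriesTerm k ≡ 2ℚ * τ 0 k
seriesTerm≡2τ k = begin
  seriesTerm k
    ≡⟨ cong₂ (λ p q → p * q * (H⁽²⁾ (2 ℕ.* k ℕ.+ 1) - + 5 / 4 * H⁽²⁾ k))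
         (trans (ι-def (3 ℕ.* k ℕ.+ 2)) (ι-3k+2 k))
         (÷-unique {{denominator-nonZero k}} (o*κ*denominator k)) ⟩
  q * (o k * κ 0 k) * (H⁽²⁾ (2 ℕ.* k ℕ.+ 1) - + 5 / 4 * H⁽²⁾ k)
    ≡⟨ cong (q * (o k * κ 0 k) *_) (harmonic-factor k) ⟩
  q * (o k * κ 0 k) * Λ 0 k
    ≡⟨ solve 4 (λ q c F Λ → q :* (c :* F) :* Λ := con 2ℚ :* (con ½ :* q :* c :* (F :* Λ))) refl q (o k) (κ 0 k) (Λ 0 k) ⟩
  2ℚ * τ 0 k   ∎
  where
  open ≡-Reasoning
  q = 2ℚ * ι 0 + 3ℚ * ι k + 2ℚ

-- Bounds on the far edges of the WZ square

h-telescope : ∀ n → h n * h (suc n) ≡ h n - h (suc n)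
h-telescope n = begin
  x' * y'                                       ≡⟨ solve 3 (λ x x' y' → x' :* y' := x' :* ((con 1ℚ :+ (con 1ℚ :+ x)) :* y') :- ((con 1ℚ :+ x) :* x') :* y') refl (ι n) x' y' ⟩
  x' * ((1ℚ + (1ℚ + ι n)) * y') - (1ℚ + ι n) * x' * y'
    ≡⟨ cong₂ (λ p q → x' * p - q * y') (trans (cong (λ z → (1ℚ + z) * y') (sym (ι-suc n))) (ι*h′ (suc n))) (ι*h′ n) ⟩
  x' * 1ℚ - 1ℚ * y'                             ≡⟨ cong₂ _-_ (*-identityʳ x') (*-identityˡ y') ⟩
  x' - y'                                       ∎
  where
  open ≡-Reasoning
  x' = h n
  y' = h (suc n)

-- The subtracted `h n` makes the induction work: the next square is at most `h n * h (suc n)`,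
-- which telescopes.
∑h²≤ : ∀ n → ∑ (suc n) (λ i → h i * h i) ≤ 2ℚ - h n
∑h²≤ zero    = ≤-reflexive (trans (cong (λ p → 0ℚ + p * p) h-zero) (cong (λ q → 2ℚ - q) (sym h-zero)))
∑h²≤ (suc n) = begin
  ∑ (suc n) (λ i → h i * h i) + y * y   ≤⟨ +-mono-≤ (∑h²≤ n) (*-monoʳ-≤-nonNeg y {{nonNegative (0≤h (suc n))}} (h-anti (ℕ.n≤1+n n))) ⟩
  2ℚ - x + x * y                        ≡⟨ cong (λ p → 2ℚ - x + p) (h-telescope n) ⟩
  2ℚ - x + (x - y)                      ≡⟨ solve 2 (λ x y → con 2ℚ :- x :+ (x :- y) := con 2ℚ :- y) refl x y ⟩
  2ℚ - y                                ∎
  where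
  open ≤-Reasoning
  x = h n
  y = h (suc n)

∑-squares≤2 : ∀ n {g : ℕ → ℚ} → (∀ i → 0ℚ ≤ g i) → (∀ i → g i ≤ h i) → ∑ n (λ i → g i * g i) ≤ 2ℚ
∑-squares≤2 n {g} 0≤g g≤h = begin
  ∑ n (λ i → g i * g i)         ≤⟨ ∑-mono n (λ i _ → *-mono-≤ (0≤g i) (g≤h i) (0≤g i) (g≤h i)) ⟩
  ∑ n (λ i → h i * h i)         ≤⟨ ≤-from-difference (0≤* (0≤h n) (0≤h n)) refl ⟩
  ∑ (suc n) (λ i → h i * h i)   ≤⟨ ∑h²≤ n ⟩
  2ℚ - h n                      ≤⟨ ≤-from-difference (0≤h n) (solve 1 (λ x → con 2ℚ := (con 2ℚ :- x) :+ x) refl (h n)) ⟩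
  2ℚ                            ∎
  where open ≤-Reasoning

difference≤ : ∀ {p q b} → p ≤ b → 0ℚ ≤ q → p - q ≤ b
difference≤ {p} {q} {b} p≤b 0≤q = ≤-trans (≤-from-difference 0≤q (solve 2 (λ p q → p := (p :- q) :+ q) refl p q)) p≤b

∣Λ∣≤2 : ∀ n k → ∣ Λ n k ∣ ≤ 2ℚ
∣Λ∣≤2 n k = ∣∣-bound (difference≤ S≤2 0≤B) (≤-trans
  (≤-reflexive (solve 2 (λ S B → :- (S :- B) := B :- S) refl S B)) (difference≤ B≤2 0≤S))
  where
  S = ∑ (suc k) (λ j → o (n ℕ.+ j) * o (n ℕ.+ j))
  B = ∑ k (λ j → h j * h j)
  S≤2 : S ≤ 2ℚ
  S≤2 = ∑-squares≤2 (suc k) (λ j → 0≤o (n ℕ.+ j))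
    (λ j → ≤-trans (o≤h (n ℕ.+ j)) (h-anti (ℕ.m≤n+m j n)))
  B≤2 : B ≤ 2ℚ
  B≤2 = ∑-squares≤2 k 0≤h (λ _ → ≤-refl)
  0≤S : 0ℚ ≤ S
  0≤S = ∑-nonNeg (suc k) (λ j → 0≤* (0≤o (n ℕ.+ j)) (0≤o (n ℕ.+ j)))
  0≤B : 0ℚ ≤ B
  0≤B = ∑-nonNeg k (λ j → 0≤* (0≤h j) (0≤h j))

0≤2 : 0ℚ ≤ 2ℚ
0≤2 = nonNegative⁻¹ 2ℚ

0≤½ : 0ℚ ≤ ½
0≤½ = nonNegative⁻¹ ½

0≤½^ : ∀ k → 0ℚ ≤ ½ ^ k
0≤½^ zero    = 0≤1
0≤½^ (suc k) = 0≤* 0≤½ (0≤½^ k)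

-- The source of geometric decay in k. The ratio is 2(y · `o k`)(yW)², where y · `o k` is at most 1
-- and yW at most 1/2, since the denominator of W is at least 2(k + 1).
κ-ratio : ∀ n k → let y = 1ℚ + ι k; W = o (n ℕ.+ suc k); r = 2ℚ * y * y * y * o k * (W * W) in
  0ℚ ≤ r × r ≤ ½
κ-ratio n k = 0≤* (0≤* (0≤* (0≤* (0≤* 0≤2 0≤y) 0≤y) 0≤y) (0≤o k)) (0≤* 0≤W 0≤W) , (begin
  2ℚ * y * y * y * o k * (W * W)
    ≡⟨ solve 3 (λ y c W → con 2ℚ :* y :* y :* y :* c :* (W :* W) := con 2ℚ :* ((y :* c) :* ((y :* W) :* (y :* W)))) refl y (o k) W ⟩
  2ℚ * ((y * o k) * ((y * W) * (y * W)))
    ≤⟨ *-monoˡ-≤-nonNeg 2ℚ (*-mono-≤ (0≤* 0≤y (0≤o k)) yc≤1 (0≤* 0≤yW 0≤yW) (*-mono-≤ 0≤yW yW≤½ 0≤yW yW≤½)) ⟩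
  2ℚ * (1ℚ * (½ * ½))
    ≡⟨⟩
  ½   ∎)
  where
  open ≤-Reasoning
  y = 1ℚ + ι k
  W = o (n ℕ.+ suc k)
  0≤y : 0ℚ ≤ y
  0≤y = 0≤+ 0≤1 (0≤ι k)
  0≤W : 0ℚ ≤ W
  0≤W = 0≤o (n ℕ.+ suc k)
  0≤yW : 0ℚ ≤ y * W
  0≤yW = 0≤* 0≤y 0≤W
  yc≤1 : y * o k ≤ 1ℚ
  yc≤1 = ≤-trans (*-monoˡ-≤-nonNeg y {{nonNegative 0≤y}} (o≤h k)) (≤-reflexive (ι*h′ k))
  2k+1≤ : suc (2 ℕ.* k) ℕ.≤ 2 ℕ.* (n ℕ.+ suc k)
  2k+1≤ = ℕ.≤-trans (ℕ.≤-trans (ℕ.n≤1+n _) (ℕ.≤-reflexive (sym (ℕ.*-suc 2 k)))) (ℕ.*-monoʳ-≤ 2 (ℕ.m≤n+m (suc k) n))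
  yW≤½ : y * W ≤ ½
  yW≤½ = begin
    y * W                   ≤⟨ *-monoˡ-≤-nonNeg y {{nonNegative 0≤y}} (h-anti 2k+1≤) ⟩
    y * h (suc (2 ℕ.* k))   ≡⟨ cong (y *_) (h-half k) ⟩
    y * (½ * h k)           ≡⟨ solve 2 (λ y x → y :* (con ½ :* x) := con ½ :* (y :* x)) refl y (h k) ⟩
    ½ * (y * h k)           ≡⟨ cong (½ *_) (ι*h′ k) ⟩
    ½ * 1ℚ                  ≡⟨ *-identityʳ ½ ⟩
    ½                       ∎

0≤κ : ∀ n k → 0ℚ ≤ κ n k
0≤κ n zero    = 0≤* (0≤o n) (0≤o n)
0≤κ n (suc k) = 0≤* (0≤κ n k) (proj₁ (κ-ratio n k))

κ≤ : ∀ n k → κ n k ≤ ½ ^ k * (o n * o n)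
κ≤ n zero    = ≤-reflexive (sym (*-identityˡ (o n * o n)))
κ≤ n (suc k) = ≤-trans (*-mono-≤ (0≤κ n k) (κ≤ n k) (proj₁ (κ-ratio n k)) (proj₂ (κ-ratio n k)))
  (≤-reflexive (solve 2 (λ p v → p :* v :* con ½ := con ½ :* p :* v) refl (½ ^ k) (o n * o n)))

∣κ*Λ∣≤ : ∀ n k → ∣ κ n k * Λ n k ∣ ≤ 2ℚ * ½ ^ k * (o n * o n)
∣κ*Λ∣≤ n k = begin
  ∣ κ n k * Λ n k ∣               ≡⟨ cong ∣_∣ (*-comm (κ n k) (Λ n k)) ⟩
  ∣ Λ n k * κ n k ∣               ≤⟨ ∣p*q∣≤ (0≤κ n k) (∣Λ∣≤2 n k) ⟩
  2ℚ * κ n k                      ≤⟨ *-monoˡ-≤-nonNeg 2ℚ (κ≤ n k) ⟩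
  2ℚ * (½ ^ k * (o n * o n))      ≡⟨ *-assoc 2ℚ (½ ^ k) (o n * o n) ⟨
  2ℚ * ½ ^ k * (o n * o n)        ∎
  where open ≤-Reasoning

∣τ∣≤ : ∀ n k → ∣ τ n k ∣ ≤ 2ℚ * o n * ½ ^ k
∣τ∣≤ n k = begin
  ∣ ½ * (2ℚ * x + 3ℚ * y + 2ℚ) * c * (κ n k * Λ n k) ∣
    ≡⟨ cong ∣_∣ (*-comm _ (κ n k * Λ n k)) ⟩
  ∣ κ n k * Λ n k * (½ * (2ℚ * x + 3ℚ * y + 2ℚ) * c) ∣
    ≤⟨ ∣p*q∣≤ (0≤* (0≤* 0≤½ 0≤q) (0≤o k)) (∣κ*Λ∣≤ n k) ⟩
  2ℚ * ½ ^ k * (v * v) * (½ * (2ℚ * x + 3ℚ * y + 2ℚ) * c)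
    -- The linear prefactor is dominated by (2n + 1)(2k + 1), which cancels one `o n` and the `o k`;
    -- a single `o n` survives to give decay in n.
    ≤⟨ ≤-from-difference (0≤* (0≤* (0≤* (0≤½^ k) (0≤* (0≤o n) (0≤o n))) 0≤r) (0≤o k))
         (solve 5 (λ p v c x y →
            con 2ℚ :* p :* v :* ((con 1ℚ :+ con 2ℚ :* x) :* v) :* ((con 1ℚ :+ con 2ℚ :* y) :* c)
            := con 2ℚ :* p :* (v :* v) :* (con ½ :* (con 2ℚ :* x :+ con 3ℚ :* y :+ con 2ℚ) :* c)
               :+ p :* (v :* v) :* (con 2ℚ :* x :+ y :+ con 2ℚ :* con 4ℚ :* (x :* y)) :* c) refl (½ ^ k) v c x y) ⟩
  2ℚ * ½ ^ k * v * ((1ℚ + 2ℚ * x) * v) * ((1ℚ + 2ℚ * y) * c)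
    ≡⟨ cong₂ (λ p q → 2ℚ * ½ ^ k * v * p * q) (ι*o n) (ι*o k) ⟩
  2ℚ * ½ ^ k * v * 1ℚ * 1ℚ
    ≡⟨ solve 2 (λ p v → con 2ℚ :* p :* v :* con 1ℚ :* con 1ℚ := con 2ℚ :* v :* p) refl (½ ^ k) v ⟩
  2ℚ * v * ½ ^ k   ∎
  where
  open ≤-Reasoning
  x = ι n
  y = ι k
  v = o n
  c = o k
  0≤q : 0ℚ ≤ 2ℚ * x + 3ℚ * y + 2ℚ
  0≤q = 0≤+ (0≤+ (0≤* 0≤2 (0≤ι n)) (0≤* (nonNegative⁻¹ 3ℚ) (0≤ι k))) 0≤2
  0≤r : 0ℚ ≤ 2ℚ * x + y + 2ℚ * 4ℚ * (x * y)
  0≤r = 0≤+ (0≤+ (0≤* 0≤2 (0≤ι n)) (0≤ι k)) (0≤* (nonNegative⁻¹ (2ℚ * 4ℚ)) (0≤* (0≤ι n) (0≤ι k)))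

∑½^≤2 : ∀ n → ∑ n (½ ^_) ≤ 2ℚ
∑½^≤2 n = ≤-from-difference (0≤* 0≤2 (0≤½^ n)) (sym (partial n))
  where
  partial : ∀ n → ∑ n (½ ^_) + 2ℚ * ½ ^ n ≡ 2ℚ
  partial zero    = refl
  partial (suc n) = trans (solve 2 (λ S p → (S :+ p) :+ con 2ℚ :* (con ½ :* p) := S :+ con 2ℚ :* p) refl (∑ n (½ ^_)) (½ ^ n)) (partial n)

½^≤h : ∀ n → ½ ^ n ≤ h n
½^≤h zero    = ≤-reflexive (sym h-zero)
½^≤h (suc n) = begin
  ½ * ½ ^ n           ≤⟨ *-monoˡ-≤-nonNeg ½ (½^≤h n) ⟩
  ½ * h n             ≡⟨ h-half n ⟨
  h (suc (2 ℕ.* n))   ≤⟨ h-anti (ℕ.s≤s (ℕ.m≤m+n n (n ℕ.+ 0))) ⟩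
  h (suc n)           ∎
  where open ≤-Reasoning

t₂≤2 : ∀ n → t₂ n ≤ 2ℚ
t₂≤2 n = ∑-squares≤2 n 0≤o o≤h

-- On the edge n = M a geometric series is multiplied by `o M`; on the edge k = M a bounded sum is
-- multiplied by `½ ^ M`. Each is at most a constant times `h M`.
∣wz-error∣≤ : ∀ M → ∣ ∑ M (τ M) - ∑ M (λ n → κ n M * Λ n M) ∣ ≤ 2ℚ * 4ℚ * h M
∣wz-error∣≤ M = begin
  ∣ ∑ M (τ M) - B ∣                ≤⟨ ∣p-q∣≤∣p∣+∣q∣ (∑ M (τ M)) B ⟩
  ∣ ∑ M (τ M) ∣ + ∣ B ∣            ≤⟨ +-mono-≤ (∣∑∣≤ M (λ k _ → ∣τ∣≤ M k)) (∣∑∣≤ M (λ n _ → ∣κ*Λ∣≤ n M)) ⟩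
  ∑ M (λ k → 2ℚ * o M * ½ ^ k) + ∑ M (λ n → 2ℚ * ½ ^ M * (o n * o n))
    ≡⟨ cong₂ _+_ (∑-* M (2ℚ * o M) (½ ^_)) (∑-* M (2ℚ * ½ ^ M) (λ n → o n * o n)) ⟩
  2ℚ * o M * ∑ M (½ ^_) + 2ℚ * ½ ^ M * t₂ M
    ≤⟨ +-mono-≤
         (*-mono-≤ (0≤* 0≤2 (0≤o M)) (*-monoˡ-≤-nonNeg 2ℚ (o≤h M)) (∑-nonNeg M 0≤½^) (∑½^≤2 M))
         (*-mono-≤ (0≤* 0≤2 (0≤½^ M)) (*-monoˡ-≤-nonNeg 2ℚ (½^≤h M)) (∑-nonNeg M (λ n → 0≤* (0≤o n) (0≤o n))) (t₂≤2 M)) ⟩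
  2ℚ * h M * 2ℚ + 2ℚ * h M * 2ℚ
    ≡⟨ solve 1 (λ x → con 2ℚ :* x :* con 2ℚ :+ con 2ℚ :* x :* con 2ℚ := con 2ℚ :* con 4ℚ :* x) refl (h M) ⟩
  2ℚ * 4ℚ * h M                    ∎
  where
  open ≤-Reasoning
  B = ∑ M (λ n → κ n M * Λ n M)

∣∑seriesTerm-2t₄∣≤ : ∀ n → ∣ ∑ n seriesTerm - 2ℚ * t₄ n ∣ ≤ 4ℚ * 4ℚ * h n
∣∑seriesTerm-2t₄∣≤ n = begin
  ∣ ∑ n seriesTerm - 2ℚ * t₄ n ∣
    ≡⟨ cong (λ p → ∣ p - 2ℚ * t₄ n ∣) (trans (∑-cong n (λ k _ → seriesTerm≡2τ k)) (∑-* n 2ℚ (τ 0))) ⟩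
  ∣ 2ℚ * ∑ n (τ 0) - 2ℚ * t₄ n ∣
    ≡⟨ cong (λ p → ∣ 2ℚ * p - 2ℚ * t₄ n ∣) (wz-rectangle n n) ⟩
  ∣ 2ℚ * (t₄ n + D) - 2ℚ * t₄ n ∣
    ≡⟨ cong ∣_∣ (solve 2 (λ a D → con 2ℚ :* (a :+ D) :- con 2ℚ :* a := D :* con 2ℚ) refl (t₄ n) D) ⟩
  ∣ D * 2ℚ ∣
    ≤⟨ ∣p*q∣≤ 0≤2 (∣wz-error∣≤ n) ⟩
  2ℚ * 4ℚ * h n * 2ℚ
    ≡⟨ solve 1 (λ x → con 2ℚ :* con 4ℚ :* x :* con 2ℚ := con 4ℚ :* con 4ℚ :* x) refl (h n) ⟩
  4ℚ * 4ℚ * h n   ∎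
  where
  open ≤-Reasoning
  D = ∑ n (τ n) - ∑ n (λ m → κ m n * Λ m n)

-- Comparison with π⁴ and passage to the limit

leibniz≡4t₁ : ∀ n → leibniz n ≡ 4ℚ * t₁ n
leibniz≡4t₁ n = trans (∑-cong n (λ k _ → begin
    s k * leibnizTerm k   ≡⟨ cong (s k *_) (trans (/-split 4 (2 ℕ.* k)) (cong (_* o k) ι-four)) ⟩
    s k * (4ℚ * o k)      ≡⟨ solve 2 (λ σ u → σ :* (con 4ℚ :* u) := con 4ℚ :* (σ :* u)) refl (s k) (o k) ⟩
    4ℚ * (s k * o k)      ∎)) (∑-* n 4ℚ _)
  where
  open ≡-Reasoning
  ι-four : ι 4 ≡ 4ℚ
  ι-four = trans (ι-+ 2 2) (cong₂ _+_ ι-two ι-two)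

∣leibniz∣≤4 : ∀ n → ∣ leibniz n ∣ ≤ 4ℚ
∣leibniz∣≤4 n = ≤-trans (≤-reflexive (cong ∣_∣ (sym (+-identityʳ (leibniz n))))) (leibniz-close 0 n)

leibniz² : ∀ n → leibniz n * leibniz n ≡ 2ℚ * 4ℚ * (t₂ n + window a o n)
leibniz² n = begin
  leibniz n * leibniz n             ≡⟨ cong (λ p → p * p) (leibniz≡4t₁ n) ⟩
  4ℚ * t₁ n * (4ℚ * t₁ n)           ≡⟨ solve 1 (λ t → con 4ℚ :* t :* (con 4ℚ :* t) := con 2ℚ :* con 4ℚ :* (con 2ℚ :* (t :* t))) refl (t₁ n) ⟩
  2ℚ * 4ℚ * (2ℚ * (t₁ n * t₁ n))    ≡⟨ cong (2ℚ * 4ℚ *_) (2t₁²≡t₂+window n) ⟩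
  2ℚ * 4ℚ * (t₂ n + window a o n)   ∎
  where open ≡-Reasoning

π⁴/48 : ℝ
π⁴/48 = π ^ℝ 4 *ℝ fromℚ (+ 1 / 48)

⅔ 4/3 ⅛ : ℚ
⅔ = + 2 / 3
4/3 = + 4 / 3
⅛ = + 1 / 8

-- With R and Q the two windows, `leibniz²` turns the left side into (4/3)(t₂ + R)², and (2/3)(2t₂²)
-- becomes 2t₄ + (2/3)Q. The rest is (4/3)R(2t₂ + R), where t₂ + R is written back as one eighth of
-- the squared Leibniz sum so that the known bounds cover the second factor.
π⁴/48-expansion : ∀ n → approx π⁴/48 n ≡
  2ℚ * t₄ n + (window h o³ n * ⅔ + 4/3 * (window a o n * (t₂ n + ⅛ * (leibniz n * leibniz n))))
π⁴/48-expansion n = begin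
  l * (l * (l * (l * 1ℚ))) * (+ 1 / 48)
    ≡⟨ solve 1 (λ l → l :* (l :* (l :* (l :* con 1ℚ))) :* con (+ 1 / 48) := con (+ 1 / 48) :* (l :* l) :* (l :* l)) refl l ⟩
  (+ 1 / 48) * (l * l) * (l * l)
    ≡⟨ cong (λ p → (+ 1 / 48) * p * p) (leibniz² n) ⟩
  (+ 1 / 48) * (2ℚ * 4ℚ * (b + R)) * (2ℚ * 4ℚ * (b + R))
    ≡⟨ solve 2 (λ b R → con (+ 1 / 48) :* (con 2ℚ :* con 4ℚ :* (b :+ R)) :* (con 2ℚ :* con 4ℚ :* (b :+ R))
         := con ⅔ :* (con 2ℚ :* (b :* b)) :+ con 4/3 :* (R :* (b :+ con ⅛ :* (con 2ℚ :* con 4ℚ :* (b :+ R))))) refl b R ⟩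
  ⅔ * (2ℚ * (b * b)) + 4/3 * (R * (b + ⅛ * (2ℚ * 4ℚ * (b + R))))
    ≡⟨ cong₂ (λ p q → ⅔ * p + 4/3 * (R * (b + ⅛ * q))) (2t₂²≡3t₄+window n) (sym (leibniz² n)) ⟩
  ⅔ * (3ℚ * t₄ n + Q) + 4/3 * (R * (b + ⅛ * (l * l)))
    ≡⟨ solve 3 (λ t Q X → con ⅔ :* (con 3ℚ :* t :+ Q) :+ X := con 2ℚ :* t :+ (Q :* con ⅔ :+ X)) refl
         (t₄ n) Q (4/3 * (R * (b + ⅛ * (l * l)))) ⟩
  2ℚ * t₄ n + (Q * ⅔ + 4/3 * (R * (b + ⅛ * (l * l))))   ∎
  where
  open ≡-Reasoning
  l = leibniz n
  b = t₂ n
  R = window a o n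
  Q = window h o³ n

square≤ : ∀ {p b} → 0ℚ ≤ b → ∣ p ∣ ≤ b → 0ℚ ≤ p * p × p * p ≤ b * b
square≤ {p} {b} 0≤b p≤b = ≤-trans (0≤* (0≤∣p∣ p) (0≤∣p∣ p)) (≤-reflexive ∣p∣²)
  , ≤-trans (≤-reflexive (sym ∣p∣²)) (*-mono-≤ (0≤∣p∣ p) p≤b (0≤∣p∣ p) p≤b)
  where
  ∣p∣² : ∣ p ∣ * ∣ p ∣ ≡ p * p
  ∣p∣² with ∣p∣≡p∨∣p∣≡-p p
  ... | inj₁ e = cong (λ x → x * x) e
  ... | inj₂ e = trans (cong (λ x → x * x) e) (solve 1 (λ p → (:- p) :* (:- p) := p :* p) refl p)

0≤4 : 0ℚ ≤ 4ℚ
0≤4 = nonNegative⁻¹ 4ℚ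

∣2t₄-π⁴/48∣≤ : ∀ n → ∣ 2ℚ * t₄ n - approx π⁴/48 n ∣ ≤ 3ℚ * 2ℚ * E n
∣2t₄-π⁴/48∣≤ n = begin
  ∣ 2ℚ * t₄ n - approx π⁴/48 n ∣
    ≡⟨ cong ∣_∣ (trans (cong (λ p → 2ℚ * t₄ n - p) (π⁴/48-expansion n))
         (solve 2 (λ t x → t :- (t :+ x) := :- x) refl (2ℚ * t₄ n) X)) ⟩
  ∣ - X ∣
    ≡⟨ ∣-p∣≡∣p∣ X ⟩
  ∣ Q * ⅔ + 4/3 * (R * m) ∣
    ≤⟨ ∣p+q∣≤∣p∣+∣q∣ (Q * ⅔) (4/3 * (R * m)) ⟩
  ∣ Q * ⅔ ∣ + ∣ 4/3 * (R * m) ∣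
    ≡⟨ cong (λ p → ∣ Q * ⅔ ∣ + ∣ p ∣) (solve 2 (λ R m → con 4/3 :* (R :* m) := R :* (m :* con 4/3)) refl R m) ⟩
  ∣ Q * ⅔ ∣ + ∣ R * (m * 4/3) ∣
    ≤⟨ +-mono-≤ (∣p*q∣≤ (nonNegative⁻¹ ⅔) (∣window-h∣≤ n)) (∣p*q∣≤ (0≤* 0≤m (nonNegative⁻¹ 4/3)) (∣window-a∣≤ n)) ⟩
  E n * ⅔ + E n * (m * 4/3)
    ≤⟨ +-monoʳ-≤ (E n * ⅔) (*-monoˡ-≤-nonNeg (E n) {{nonNegative 0≤E}} (*-monoʳ-≤-nonNeg 4/3 m≤4)) ⟩
  E n * ⅔ + E n * (4ℚ * 4/3)
    ≡⟨ solve 1 (λ e → e :* con ⅔ :+ e :* (con 4ℚ :* con 4/3) := con 3ℚ :* con 2ℚ :* e) refl (E n) ⟩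
  3ℚ * 2ℚ * E n   ∎
  where
  open ≤-Reasoning
  R = window a o n
  Q = window h o³ n
  l² = leibniz n * leibniz n
  m = t₂ n + ⅛ * l²
  X = Q * ⅔ + 4/3 * (R * m)
  l²-bounds : 0ℚ ≤ l² × l² ≤ 4ℚ * 4ℚ
  l²-bounds = square≤ 0≤4 (∣leibniz∣≤4 n)
  0≤m : 0ℚ ≤ m
  0≤m = 0≤+ (∑-nonNeg n (λ i → 0≤* (0≤o i) (0≤o i))) (0≤* (nonNegative⁻¹ ⅛) (proj₁ l²-bounds))
  m≤4 : m ≤ 4ℚ
  m≤4 = +-mono-≤ (t₂≤2 n) (*-monoˡ-≤-nonNeg ⅛ (proj₂ l²-bounds))
  0≤E : 0ℚ ≤ E n
  0≤E = ≤-trans (0≤∣p∣ R) (∣window-a∣≤ n)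

∣∑seriesTerm-π⁴/48∣≤ : ∀ n → ∣ ∑ n seriesTerm - approx π⁴/48 n ∣ ≤ 4ℚ * 4ℚ * h n + 3ℚ * 2ℚ * 3ℚ * (o n * H n)
∣∑seriesTerm-π⁴/48∣≤ n = begin
  ∣ S - P ∣
    ≡⟨ cong ∣_∣ (solve 3 (λ S P t → S :- P := (S :- t) :+ (t :- P)) refl S P (2ℚ * t₄ n)) ⟩
  ∣ (S - 2ℚ * t₄ n) + (2ℚ * t₄ n - P) ∣
    ≤⟨ ∣p+q∣≤∣p∣+∣q∣ (S - 2ℚ * t₄ n) (2ℚ * t₄ n - P) ⟩
  ∣ S - 2ℚ * t₄ n ∣ + ∣ 2ℚ * t₄ n - P ∣
    ≤⟨ +-mono-≤ (∣∑seriesTerm-2t₄∣≤ n) (≤-trans (∣2t₄-π⁴/48∣≤ n) (*-monoˡ-≤-nonNeg (3ℚ * 2ℚ) (E≤ n))) ⟩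
  4ℚ * 4ℚ * h n + 3ℚ * 2ℚ * (3ℚ * (o n * H n))
    ≡⟨ cong (_+_ (4ℚ * 4ℚ * h n)) (*-assoc (3ℚ * 2ℚ) 3ℚ (o n * H n)) ⟨
  4ℚ * 4ℚ * h n + 3ℚ * 2ℚ * 3ℚ * (o n * H n)   ∎
  where
  open ≤-Reasoning
  S = ∑ n seriesTerm
  P = approx π⁴/48 n

-- A one-sided condition, meant for nonnegative sequences.
Null : (ℕ → ℚ) → Set
Null x = ∀ ε → 0ℚ < ε → ∃[ N ] ∀ n → N ℕ.≤ n → x n ≤ ε

null-≤ : ∀ {x y} → (∀ n → x n ≤ y n) → Null y → Null x
null-≤ x≤y null ε 0<ε with null ε 0<ε
... | N , y≤ε = N , λ n N≤n → ≤-trans (x≤y n) (y≤ε n N≤n)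

null-+ : ∀ {x y} → Null x → Null y → Null (λ n → x n + y n)
null-+ null-x null-y ε 0<ε with null-x (½ * ε) (halve 0<ε) | null-y (½ * ε) (halve 0<ε)
... | M , x≤ | N , y≤ = M ℕ.⊔ N , λ n M⊔N≤n → ≤-trans
  (+-mono-≤ (x≤ n (ℕ.m⊔n≤o⇒m≤o M N M⊔N≤n)) (y≤ n (ℕ.m⊔n≤o⇒n≤o M N M⊔N≤n))) (≤-reflexive (halves ε))

null-* : ∀ {x} c → 0ℚ < c → Null x → Null (λ n → c * x n)
null-* c 0<c null ε 0<ε with quotient c ε 0<c 0<ε
... | α , 0<α , cα≡ε with null α 0<α
...   | N , x≤α = N , λ n N≤n → ≤-trans
  (*-monoˡ-≤-nonNeg c {{nonNegative (<⇒≤ 0<c)}} (x≤α n N≤n)) (≤-reflexive cα≡ε)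

null-h : Null h
null-h ε 0<ε with 1/suc-below ε 0<ε
... | q , 1/q≤ε = q , λ n q≤n → ≤-trans (h-anti q≤n) (≤-trans (≤-reflexive (sym (h-def q))) 1/q≤ε)

square-cancel-≤ : ∀ {p q} → 0ℚ ≤ p → 0ℚ < q → p * p ≤ q * q → p ≤ q
square-cancel-≤ {p} {q} 0≤p 0<q p²≤q² with ≤-total p q
... | inj₁ p≤q = p≤q
... | inj₂ q≤p = *-cancelʳ-≤-pos q {{positive 0<q}}
  (≤-trans (*-monoˡ-≤-nonNeg p {{nonNegative 0≤p}} q≤p) p²≤q²)

null-o*H : Null (λ n → o n * H n)
null-o*H ε 0<ε with 1/suc-below ε 0<ε
-- The witness is (q + 1)² - 1, the index at which `h` equals the square of `h q`; comparing squares
-- then gives the bound `h q`.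
... | q , 1/q≤ε = q ℕ.+ q ℕ.* suc q , λ n hn → ≤-trans
  (square-cancel-≤ (0≤* (0≤o n) (0≤H n)) (0<h q)
    (≤-trans ([o*H]²≤h n) (≤-trans (h-anti hn) (≤-reflexive (sym (h-* q q))))))
  (≤-trans (≤-reflexive (sym (h-def q))) 1/q≤ε)

approx-∑ℝ : ∀ n (x : ℕ → ℚ) m → approx (∑ℝ n (λ k → fromℚ (x k))) m ≡ ∑ n x
approx-∑ℝ zero    x m = refl
approx-∑ℝ (suc n) x m = cong (_+ x n) (approx-∑ℝ n x m)

-- Partial sums of embedded rationals have constant approximations, so it is enough to compare the
-- n-th sum with the n-th approximation of `L`; the Cauchy property carries this to later
-- approximations, with half of `ε` for each step.
null⇒HasSum : ∀ x L → Null (λ n → ∣ ∑ n x - approx L n ∣) → HasSum (λ k → fromℚ (x k)) L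
null⇒HasSum x L null ε 0<ε with null (½ * ε) (halve 0<ε) | cauchy L (½ * ε) (halve 0<ε)
... | M , near | N , close = M ℕ.⊔ N , λ n hn δ 0<δ → M ℕ.⊔ N , λ m hm → begin
  ∣ approx (∑ℝ n (λ k → fromℚ (x k))) m - approx L m ∣
    ≡⟨ cong ∣_∣ (trans (cong (_- approx L m) (approx-∑ℝ n x m))
         (solve 3 (λ S l l′ → S :- l′ := (S :- l) :+ (l :- l′)) refl (∑ n x) (approx L n) (approx L m))) ⟩
  ∣ (∑ n x - approx L n) + (approx L n - approx L m) ∣
    ≤⟨ ∣p+q∣≤∣p∣+∣q∣ (∑ n x - approx L n) (approx L n - approx L m) ⟩
  ∣ ∑ n x - approx L n ∣ + ∣ approx L n - approx L m ∣
    ≤⟨ +-mono-≤ (near n (ℕ.m⊔n≤o⇒m≤o M N hn))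
         (<⇒≤ (close n m (ℕ.m⊔n≤o⇒n≤o M N hn) (ℕ.m⊔n≤o⇒n≤o M N hm))) ⟩
  ½ * ε + ½ * ε
    ≡⟨ halves ε ⟩
  ε
    ≤⟨ ≤-from-difference (<⇒≤ 0<δ) refl ⟩
  ε + δ   ∎
  where open ≤-Reasoning

theorem1p1 : HasSum (λ k → fromℚ (seriesTerm k)) (π ^ℝ 4 *ℝ fromℚ (+ 1 / 48))
theorem1p1 = null⇒HasSum seriesTerm π⁴/48 (null-≤ ∣∑seriesTerm-π⁴/48∣≤
  (null-+ (null-* (4ℚ * 4ℚ) (positive⁻¹ (4ℚ * 4ℚ)) null-h)
          (null-* (3ℚ * 2ℚ * 3ℚ) (positive⁻¹ (3ℚ * 2ℚ * 3ℚ)) null-o*H)))
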